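{- Let $X=\prod_n Y_n$ be the product of a countable family of profinite spaces $Y_n$, such that the procounting distribution $\mu_{Y_n}$ exists for every $n$, and consider a subset $S=\prod_n T_n$, where $T_n\subseteq Y_n$ for all $n$. If the procounting distribution $\mu_{T_n}$ exists for every $n$, then the procounting distribution $\mu_S$ exists too, and one has $$\mu_S=\bigotimes_n\mu_{T_n},$$ meaning that for any compact open $U=\prod_n U_n\subseteq X$, with $U_n\subseteq Y_n$, one has $\mu_S(\mathbf 1_U)=\prod_n\mu_{T_n}(\mathbf 1_{U_n})$.
   Context: Conventions. $R$ is a commutative unitary topological ring which is a $\mathbb Q$-algebra and whose topology is induced by a non-trivial absolute value. A profinite space $X$ comes with a presentation $X=\varprojlim_{\alpha\in\mathcal J}X_\alpha$, with $X_\alpha$ finite (discrete), $\mathcal J$ directed and containing a cofinal subset isomorphic to $\mathbb N$, and surjective transition maps $\pi_\alpha^\beta\colon X_\beta\to X_\alpha$ ($\beta\ge\alpha$); $\pi_\alpha\colon X\to X_\alpha$ is the projection. $\mathbf 1_U$ denotes a characteristic function. An $R$-valued distribution on $X$ is an $R$-linear functional on the locally constant functions $X\to R$; equivalently, a finitely additive $R$-valued function $U\mapsto\mu(\mathbf 1_U)$ on compact open subsets of $X$. The space $\mathcal D(X,R)$ of distributions has the weak-* topology (pointwise convergence on the functions $\mathbf 1_U$, $U$ compact open). Procounting distributions. The procounting distribution $\mu_X$ of the whole space is the distribution whose push-forward to each $X_\alpha$ is $\frac1{|X_\alpha|}\sum_{x\in X_\alpha}\delta_x$, if it exists. Assume $\mu_X$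 exists. For nonempty $S\subseteq X$ put $$\widetilde\mu_{S,\alpha}:=\frac{|X_\alpha|}{|\pi_\alpha(S)|}\,\mathbf 1_{\pi_\alpha^{ -1}(\pi_\alpha(S))}\cdot\mu_X,\qquad\text{where }(f\cdot\mu)(g):=\mu(fg),$$ and $\widetilde\mu_{\emptyset,\alpha}:=0$. (If $U=\pi_\alpha^{ -1}(\pi_\alpha(U))$ then $\widetilde\mu_{S,\alpha}(\mathbf 1_U)=|\pi_\alpha(U)\cap\pi_\alpha(S)|/|\pi_\alpha(S)|$.) The procounting distribution of $S$ is $\mu_S:=\lim_{\alpha\in\mathcal J}\widetilde\mu_{S,\alpha}$ in $\mathcal D(X,R)$, if the limit of this net exists. Products. If $Y_n=\varprojlim_{\alpha_n\in\mathcal J_n}Y_{n,\alpha_n}$, then $X=\prod_nY_n$ is presented as $\varprojlim_{\alpha}X_\alpha$, where $\alpha=(\alpha_n)_{n\in K}$ varies in $\bigcup_K\prod_{n\in K}\mathcal J_n$ ($K$ ranging over finite sets of indices), $X_\alpha=\prod_{n\in K}Y_{n,\alpha_n}$, and $(\beta_n)_{n\in K'}\ge(\alpha_n)_{n\in K}$ iff $K\subseteq K'$ and $\beta_n\ge\alpha_n$ for all $n\in K$. -}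

module Defs where

open import Level using (0ℓ)
open import Algebra.Bundles using (CommutativeRing)
import Algebra.Properties.CommutativeMonoid.Sum as FiniteSum
open import Algebra.Morphism.Structures using (IsRingHomomorphism)
open import Axiom.ExcludedMiddle using (ExcludedMiddle)
open import Data.Bool.Base using (if_then_else_)
open import Data.Fin.Base as Fin using (Fin; combine; remQuot)
import Data.Fin.Properties as Fin
open import Data.Integer.Base using (+_)
open import Data.List.Base using (List; []; _∷_; _++_; length; filter; foldr; allFin; deduplicate)
open import Data.List.Membership.Propositional using (_∈_)
open import Data.List.Membership.Propositional.Properties using (∈-++⁺ˡ; ∈-++⁺ʳ; ∈-deduplicate⁺; ∈-deduplicate⁻)
open import Data.List.Membership.Propositional.Properties.WithK using (unique⇒irrelevant)
open import Data.List.Relation.Binary.Subset.Propositional using (_⊆_)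
open import Data.List.Relation.Unary.Any using (Any; here; there)
open import Data.List.Relation.Unary.Unique.Propositional using (Unique; []; _∷_)
import Data.List.Relation.Unary.All as All
import Data.List.Relation.Unary.Unique.DecPropositional.Properties as UniqueDec
open import Data.Nat.Base as ℕ using (ℕ; zero; suc)
open import Data.Product.Base using (∃; _×_; _,_; proj₁; proj₂)
open import Data.Rational.Base as ℚ using (ℚ; 0ℚ; 1ℚ; _/_)
import Data.Rational.Properties as ℚ
open import Function.Bundles using (Func; Inverse; _⇔_)
open import Function.Definitions using (StrictlySurjective)
open import Relation.Binary.Bundles using (Setoid)
open import Relation.Binary.Core using (Rel)
open import Relation.Binary.Definitions using (DecidableEquality)
open import Relation.Binary.PropositionalEquality as ≡ using (_≡_; refl)
open import Relation.Binary.Structures using (IsPreorder)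
open import Relation.Nullary using (¬_; Dec; yes; no; does; contradiction)

-- A Dedekind cut, given by its upper half: `upper q` means x < q.  Under
-- excluded middle, which the theorem assumes, the lower half is determined.
record ℝ≥0 : Set₁ where
  field
    upper     : ℚ → Set
    inhabited : ∃ upper
    positive  : ∀ {q} → upper q → 0ℚ ℚ.< q
    upward    : ∀ {q r} → upper q → q ℚ.< r → upper r
    rounded   : ∀ {q} → upper q → ∃ λ p → p ℚ.< q × upper p

open ℝ≥0

infix 4 _<ʳ_ _≤ʳ_ _≈ʳ_
infixl 6 _+ʳ_
infixl 7 _*ʳ_

_<ʳ_ : ℝ≥0 → ℚ → Set
x <ʳ q = upper x q

_≤ʳ_ : ℝ≥0 → ℝ≥0 → Set
x ≤ʳ y = ∀ q → y <ʳ q → x <ʳ q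

_≈ʳ_ : ℝ≥0 → ℝ≥0 → Set
x ≈ʳ y = x ≤ʳ y × y ≤ʳ x

fromℚ : ∀ p → 0ℚ ℚ.≤ p → ℝ≥0
fromℚ p 0≤p .upper q = p ℚ.< q
fromℚ p 0≤p .inhabited = p ℚ.+ 1ℚ , (begin-strict
  p         ≡⟨ ℚ.+-identityʳ p ⟨
  p ℚ.+ 0ℚ  <⟨ ℚ.+-monoʳ-< p (ℚ.positive⁻¹ 1ℚ) ⟩
  p ℚ.+ 1ℚ  ∎)
  where open ℚ.≤-Reasoning
fromℚ p 0≤p .positive = ℚ.≤-<-trans 0≤p
fromℚ p 0≤p .upward = ℚ.<-trans
fromℚ p 0≤p .rounded p<q with m , p<m , m<q ← ℚ.<-dense p<q = m , m<q , p<m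

0ʳ 1ʳ : ℝ≥0
0ʳ = fromℚ 0ℚ ℚ.≤-refl
1ʳ = fromℚ 1ℚ (ℚ.nonNegative⁻¹ 1ℚ)

_+ʳ_ : ℝ≥0 → ℝ≥0 → ℝ≥0
(x +ʳ y) .upper r = ∃ λ p → ∃ λ q → x <ʳ p × y <ʳ q × p ℚ.+ q ℚ.≤ r
(x +ʳ y) .inhabited with p , xp ← x .inhabited | q , yq ← y .inhabited =
  p ℚ.+ q , p , q , xp , yq , ℚ.≤-refl
(x +ʳ y) .positive (p , q , xp , yq , le) =
  ℚ.<-≤-trans (ℚ.+-mono-< (x .positive xp) (y .positive yq)) le
(x +ʳ y) .upward (p , q , xp , yq , le) r<s =
  p , q , xp , yq , ℚ.≤-trans le (ℚ.<⇒≤ r<s)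
(x +ʳ y) .rounded (p , q , xp , yq , le) with p′ , p′<p , xp′ ← x .rounded xp =
  p′ ℚ.+ q , ℚ.<-≤-trans (ℚ.+-monoˡ-< q p′<p) le , p′ , q , xp′ , yq , ℚ.≤-refl

_*ʳ_ : ℝ≥0 → ℝ≥0 → ℝ≥0
(x *ʳ y) .upper r = ∃ λ p → ∃ λ q → x <ʳ p × y <ʳ q × p ℚ.* q ℚ.≤ r
(x *ʳ y) .inhabited with p , xp ← x .inhabited | q , yq ← y .inhabited =
  p ℚ.* q , p , q , xp , yq , ℚ.≤-refl
(x *ʳ y) .positive (p , q , xp , yq , le) = ℚ.<-≤-trans (ℚ.positive⁻¹ (p ℚ.* q)) le
  where
  instance
    p>0 : ℚ.Positive p
    p>0 = ℚ.positive (x .positive xp)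
    q>0 : ℚ.Positive q
    q>0 = ℚ.positive (y .positive yq)
    pq>0 : ℚ.Positive (p ℚ.* q)
    pq>0 = ℚ.pos*pos⇒pos p q
(x *ʳ y) .upward (p , q , xp , yq , le) r<s =
  p , q , xp , yq , ℚ.≤-trans le (ℚ.<⇒≤ r<s)
(x *ʳ y) .rounded (p , q , xp , yq , le) with p′ , p′<p , xp′ ← x .rounded xp =
  p′ ℚ.* q , ℚ.<-≤-trans (ℚ.*-monoˡ-<-pos q p′<p) le , p′ , q , xp′ , yq , ℚ.≤-refl
  where
  instance
    q>0 : ℚ.Positive q
    q>0 = ℚ.positive (y .positive yq)

-- The topology is the one with basic neighbourhoods {y : ∣y - x∣ < ε};
-- rational radii ε suffice.
record ValuedℚAlgebra : Set₁ where
  field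
    commutativeRing : CommutativeRing 0ℓ 0ℓ

  open CommutativeRing commutativeRing public

  field
    ι                : ℚ → Carrier
    ι-isHomomorphism : IsRingHomomorphism ℚ.+-*-rawRing rawRing ι

    ∣_∣        : Carrier → ℝ≥0
    ∣∣-cong    : ∀ {x y} → x ≈ y → ∣ x ∣ ≈ʳ ∣ y ∣
    ∣∣-zero    : ∀ x → (∣ x ∣ ≈ʳ 0ʳ) ⇔ (x ≈ 0#)
    ∣∣-*       : ∀ x y → ∣ x * y ∣ ≈ʳ ∣ x ∣ *ʳ ∣ y ∣
    ∣∣-+       : ∀ x y → ∣ x + y ∣ ≤ʳ ∣ x ∣ +ʳ ∣ y ∣
    nontrivial : ∃ λ x → ¬ (x ≈ 0#) × ¬ (∣ x ∣ ≈ʳ 1ʳ)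

  -- Only meaningful when (D , _≤_) is directed and nonempty.
  Converges : {D : Set} → Rel D 0ℓ → (D → Carrier) → Carrier → Set
  Converges _≤_ x a =
    ∀ ε → 0ℚ ℚ.< ε → ∃ λ d₀ → ∀ d → d₀ ≤ d → ∣ x d - a ∣ <ʳ ε

record Finite (A : Setoid 0ℓ 0ℓ) : Set where
  field
    size        : ℕ
    enumeration : Inverse A (≡.setoid (Fin size))

  element : Fin size → Setoid.Carrier A
  element = Inverse.from enumeration

record FiniteSubset (I : Set) : Set where
  field
    elements : List I
    unique   : Unique elements

open FiniteSubset

_⊑_ : ∀ {I} → Rel (FiniteSubset I) 0ℓ
K ⊑ L = elements K ⊆ elements L

-- X is a limit of the X_α because points are separated by the projections
-- and every compatible thread comes from a point.  Being inhabited is forced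
-- by the existence of the procounting distribution of X (|X_α| must be
-- invertible), and makes the transition maps of products surjective.
record Presentation : Set₁ where
  infix 4 _≤_
  field
    Index      : Set
    _≤_        : Rel Index 0ℓ
    isPreorder : IsPreorder _≡_ _≤_
    index₀     : Index
    directed   : ∀ α β → ∃ λ γ → α ≤ γ × β ≤ γ

    level  : Index → Setoid 0ℓ 0ℓ
    finite : ∀ α → Finite (level α)

    transition            : ∀ {α β} → α ≤ β → Func (level β) (level α)
    transition-surjective : ∀ {α β} (p : α ≤ β) →
      StrictlySurjective (Setoid._≈_ (level α)) (Func.to (transition p))
    transition-id         : ∀ {α} (p : α ≤ α) x →
      Setoid._≈_ (level α) (Func.to (transition p) x) x
    transition-∘          : ∀ {α β γ} (p : α ≤ β) (q : β ≤ γ) (r : α ≤ γ) x →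
      Setoid._≈_ (level α) (Func.to (transition p) (Func.to (transition q) x))
                           (Func.to (transition r) x)

    space : Setoid 0ℓ 0ℓ
    proj  : ∀ α → Func space (level α)

  open Setoid space public using () renaming (Carrier to Point; _≈_ to _≈ₚ_)

  π : ∀ α → Point → Setoid.Carrier (level α)
  π α = Func.to (proj α)

  _≈[_]_ : Point → Index → Point → Set
  x ≈[ α ] y = Setoid._≈_ (level α) (π α x) (π α y)

  field
    compatible : ∀ {α β} (p : α ≤ β) x →
      Setoid._≈_ (level α) (Func.to (transition p) (π β x)) (π α x)
    separated  : ∀ {x y} → (∀ α → x ≈[ α ] y) → x ≈ₚ y
    complete   : (t : ∀ α → Setoid.Carrier (level α)) →
      (∀ {α β} (p : α ≤ β) → Setoid._≈_ (level α) (Func.to (transition p) (t β)) (t α)) →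
      ∃ λ x → ∀ α → Setoid._≈_ (level α) (π α x) (t α)
    point₀     : Point

  open IsPreorder isPreorder public using () renaming (refl to ≤-refl; trans to ≤-trans)

  ∣level_∣ : Index → ℕ
  ∣level α ∣ = Finite.size (finite α)

-- A cofinal subset of the index set which is order-isomorphic to ℕ.
record CofinalSequence (X : Presentation) : Set where
  open Presentation X
  field
    chain     : ℕ → Index
    embedding : ∀ m n → (m ℕ.≤ n) ⇔ (chain m ≤ chain n)
    cofinal   : ∀ α → ∃ λ n → α ≤ chain n

record Subset (X : Presentation) : Set₁ where
  open Presentation X
  field
    member   : Point → Set
    respects : ∀ {x y} → x ≈ₚ y → member x → member y

open Subset using (member)

module _ (X : Presentation) where
  open Presentation X

  -- The cylinders {y : π_α y ≈ π_α x} are a basis of the limit topology,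
  -- because the index set is directed.
  Open : (Point → Set) → Set
  Open U = ∀ x → U x → ∃ λ α → ∀ y → x ≈[ α ] y → U y

  Compact : (Point → Set) → Set₁
  Compact U = {A : Set} (V : A → Point → Set) → (∀ a → Open (V a)) →
    (∀ x → U x → ∃ λ a → V a x) →
    ∃ λ (as : List A) → ∀ x → U x → Any (λ a → V a x) as

record CompactOpen (X : Presentation) : Set₁ where
  open Presentation X
  field
    carrier : Point → Set
    isOpen  : Open X carrier
    compact : Compact X carrier

module _ (X : Presentation) where
  open Presentation X

  ≈-sym : ∀ {α x y} → x ≈[ α ] y → y ≈[ α ] x
  ≈-sym {α} = Setoid.sym (level α)

  ≈-trans : ∀ {α x y z} → x ≈[ α ] y → y ≈[ α ] z → x ≈[ α ] z
  ≈-trans {α} = Setoid.trans (level α)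

  ≈[]-coarsen : ∀ {α β x y} → α ≤ β → x ≈[ β ] y → x ≈[ α ] y
  ≈[]-coarsen {α} {β} {x} {y} p e =
    S.trans (S.sym (compatible p x)) (S.trans (Func.cong (transition p) e) (compatible p y))
    where module S = Setoid (level α)

  upperBound : {A : Set} (f : A → Index) (as : List A) →
    ∃ λ γ → ∀ {P : A → Set} → Any P as → ∃ λ a → P a × f a ≤ γ
  upperBound f [] = index₀ , λ ()
  upperBound f (a ∷ as)
    with γ , bound ← upperBound f as
    with δ , p , q ← directed (f a) γ
    = δ , λ { (here pa) → a , pa , p
            ; (there i) → let b , pb , r = bound i in b , pb , ≤-trans r q }

  -- A compact open set is a union of fibres of a single projection.
  compactOpen-level : (U : CompactOpen X) → let open CompactOpen U in
    ∃ λ γ → ∀ x y → x ≈[ γ ] y → carrier x → carrier y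
  compactOpen-level U = γ , λ x y e u →
    let (z , v) , z≈x , q = bound (cover x u)
    in proj₂ (isOpen z v) y (≈-trans z≈x (≈[]-coarsen q e))
    where
    open CompactOpen U

    radius : ∃ carrier → Index
    radius (x , u) = proj₁ (isOpen x u)

    subcover : ∃ λ (as : List (∃ carrier)) → ∀ y → carrier y →
      Any (λ a → proj₁ a ≈[ radius a ] y) as
    subcover = compact (λ a y → proj₁ a ≈[ radius a ] y)
      (λ a y e → radius a , λ z → ≈-trans e)
      (λ x u → (x , u) , Setoid.refl (level _))

    cover = proj₂ subcover
    γ     = proj₁ (upperBound radius (proj₁ subcover))

    bound : {P : ∃ carrier → Set} → Any P (proj₁ subcover) → ∃ λ a → P a × radius a ≤ γ
    bound = proj₂ (upperBound radius (proj₁ subcover))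

module Product (em : ExcludedMiddle 0ℓ) {I : Set} (Y : I → Presentation) where

  private
    module Y i = Presentation (Y i)

    _≟_ : DecidableEquality I
    _ ≟ _ = em

    _∈?_ : ∀ i (K : List I) → Dec (i ∈ K)
    _ ∈? _ = em

  record ProductIndex : Set where
    field
      support : FiniteSubset I
      at      : ∀ i → i ∈ elements support → Y.Index i

  open ProductIndex

  same : ∀ (K : FiniteSubset I) {i} (p q : i ∈ elements K) → p ≡ q
  same K = unique⇒irrelevant (unique K)

  _≤ᴾ_ : Rel ProductIndex 0ℓ
  α ≤ᴾ β = ∀ i (p : i ∈ elements (support α)) →
    ∃ λ (q : i ∈ elements (support β)) → Y._≤_ i (at α i p) (at β i q)

  ≤ᴾ-at : ∀ {α β} → α ≤ᴾ β → ∀ i (p : i ∈ elements (support α)) (q : i ∈ elements (support β)) →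
    Y._≤_ i (at α i p) (at β i q)
  ≤ᴾ-at {α} {β} h i p q with q′ , le ← h i p rewrite same (support β) q q′ = le

  ≤ᴾ-isPreorder : IsPreorder _≡_ _≤ᴾ_
  ≤ᴾ-isPreorder = record
    { isEquivalence = ≡.isEquivalence
    ; reflexive     = λ { refl i p → p , Y.≤-refl i }
    ; trans         = λ f g i p → let q , le  = f i p
                                      r , le′ = g i q
                                  in r , Y.≤-trans i le le′
    }

  ∅ : ProductIndex
  ∅ .support = record { elements = [] ; unique = [] }
  ∅ .at _ ()

  join : ∀ {i} {A B : Set} → (A → Y.Index i) → (B → Y.Index i) → Dec A → Dec B → Y.Index i
  join {i} f g (yes a) (yes b) = proj₁ (Y.directed i (f a) (g b))
  join {i} f g (yes a) (no  _) = f a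
  join {i} f g (no  _) (yes b) = g b
  join {i} f g (no  _) (no  _) = Y.index₀ i

  join-≤ˡ : ∀ {i} {A B : Set} {f : A → Y.Index i} {g : B → Y.Index i} →
    (∀ a a′ → a ≡ a′) → ∀ a da db → Y._≤_ i (f a) (join {i} f g da db)
  join-≤ˡ {i} {f = f} {g} irr a (yes a′) (yes b) rewrite irr a a′ = proj₁ (proj₂ (Y.directed i (f a′) (g b)))
  join-≤ˡ {i} irr a (yes a′) (no _) rewrite irr a a′ = Y.≤-refl i
  join-≤ˡ irr a (no ¬a) _ = contradiction a ¬a

  join-≤ʳ : ∀ {i} {A B : Set} {f : A → Y.Index i} {g : B → Y.Index i} →
    (∀ b b′ → b ≡ b′) → ∀ b da db → Y._≤_ i (g b) (join {i} f g da db)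
  join-≤ʳ {i} {f = f} {g} irr b (yes a) (yes b′) rewrite irr b b′ = proj₂ (proj₂ (Y.directed i (f a) (g b′)))
  join-≤ʳ {i} irr b (no _) (yes b′) rewrite irr b b′ = Y.≤-refl i
  join-≤ʳ irr b _ (no ¬b) = contradiction b ¬b

  ≤ᴾ-directed : ∀ α β → ∃ λ γ → α ≤ᴾ γ × β ≤ᴾ γ
  ≤ᴾ-directed α β = γ
    , (λ i p → ∈-deduplicate⁺ _≟_ (∈-++⁺ˡ p)
             , join-≤ˡ (same (support α)) p (i ∈? K) (i ∈? L))
    , (λ i q → ∈-deduplicate⁺ _≟_ (∈-++⁺ʳ K q)
             , join-≤ʳ (same (support β)) q (i ∈? K) (i ∈? L))
    where
    K = elements (support α)
    L = elements (support β)
    γ : ProductIndex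
    γ .support .elements = deduplicate _≟_ (K ++ L)
    γ .support .unique   = UniqueDec.deduplicate-! _≟_ (K ++ L)
    γ .at i _            = join {i} (at α i) (at β i) (i ∈? K) (i ∈? L)

  Π : (K : List I) → (∀ i → i ∈ K → Setoid 0ℓ 0ℓ) → Setoid 0ℓ 0ℓ
  Π K F = record
    { Carrier       = ∀ i (p : i ∈ K) → Setoid.Carrier (F i p)
    ; _≈_           = λ x y → ∀ i p → Setoid._≈_ (F i p) (x i p) (y i p)
    ; isEquivalence = record
      { refl  = λ i p → Setoid.refl (F i p)
      ; sym   = λ e i p → Setoid.sym (F i p) (e i p)
      ; trans = λ e e′ i p → Setoid.trans (F i p) (e i p) (e′ i p)
      }
    }

  Π-finite : (K : List I) (F : ∀ i → i ∈ K → Setoid 0ℓ 0ℓ) →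
    (∀ i p → Finite (F i p)) → Finite (Π K F)
  Π-finite [] F fin = record
    { size        = 1
    ; enumeration = record
      { to        = λ _ → Fin.zero
      ; from      = λ _ _ ()
      ; to-cong   = λ _ → refl
      ; from-cong = λ _ _ ()
      ; inverse   = (λ { {Fin.zero} _ → refl }) , λ _ _ ()
      }
    }
  Π-finite (k ∷ K) F fin = record
    { size        = m ℕ.* n
    ; enumeration = record
      { to        = λ x → combine (A.to (x k (here refl))) (B.to (λ i p → x i (there p)))
      ; from      = from
      ; to-cong   = λ e → ≡.cong₂ combine (A.to-cong (e k (here refl)))
                                          (B.to-cong (λ i p → e i (there p)))
      ; from-cong = λ { refl i p → Setoid.refl (F i p) }
      ; inverse   = (λ {j} e → ≡.trans
                      (≡.cong₂ combine (A.inverseˡ (e k (here refl)))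
                                       (B.inverseˡ (λ i p → e i (there p))))
                      (Fin.combine-remQuot {m} n j))
                  , λ { {x} refl → from-to x }
      }
    }
    where
    module A = Inverse (Finite.enumeration (fin k (here refl)))
    tailFinite : Finite (Π K (λ i p → F i (there p)))
    tailFinite = Π-finite K (λ i p → F i (there p)) (λ i p → fin i (there p))
    module B = Inverse (Finite.enumeration tailFinite)
    m = Finite.size (fin k (here refl))
    n = Finite.size tailFinite
    from : Fin (m ℕ.* n) → Setoid.Carrier (Π (k ∷ K) F)
    from j _ (here refl) = A.from (proj₁ (remQuot {m} n j))
    from j i (there p)   = B.from (proj₂ (remQuot {m} n j)) i p
    from-to : ∀ x → Setoid._≈_ (Π (k ∷ K) F)
      (from (combine (A.to (x k (here refl))) (B.to (λ i p → x i (there p))))) x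
    from-to x _ (here refl) = A.inverseʳ
      (≡.cong proj₁ (Fin.remQuot-combine {m} {n} (A.to (x k (here refl))) _))
    from-to x i (there p)   = B.inverseʳ
      (≡.cong proj₂ (Fin.remQuot-combine {m} {n} (A.to (x k (here refl))) _)) i p

  levelᴾ : ProductIndex → Setoid 0ℓ 0ℓ
  levelᴾ α = Π (elements (support α)) (λ i p → Y.level i (at α i p))

  transitionᴾ : ∀ {α β} → α ≤ᴾ β → Func (levelᴾ β) (levelᴾ α)
  transitionᴾ h = record
    { to   = λ y i p → Func.to (Y.transition i (proj₂ (h i p))) (y i (proj₁ (h i p)))
    ; cong = λ e i p → Func.cong (Y.transition i (proj₂ (h i p))) (e i (proj₁ (h i p)))
    }

  transition-irrelevant : ∀ i {a b} (p q : Y._≤_ i a b) y →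
    Setoid._≈_ (Y.level i a) (Func.to (Y.transition i p) y) (Func.to (Y.transition i q) y)
  transition-irrelevant i {a} {b} p q y = S.trans
    (S.sym (Y.transition-∘ i q (Y.≤-refl i) p y))
    (Func.cong (Y.transition i q) (Y.transition-id i (Y.≤-refl i) y))
    where module S = Setoid (Y.level i a)

  single : ∀ i → Y.Index i → ProductIndex
  single i a .support = record { elements = i ∷ [] ; unique = All.[] ∷ [] }
  single i a .at _ (here refl) = a

  transitionᴾ-surjective : ∀ {α β} (h : α ≤ᴾ β) →
    StrictlySurjective (Setoid._≈_ (levelᴾ α)) (Func.to (transitionᴾ {α} {β} h))
  transitionᴾ-surjective {α} {β} h z =
    (λ i q → preimage i q (i ∈? elements (support α))) ,
    (λ i p → preimage-correct i p (proj₁ (h i p)) (proj₂ (h i p)) (i ∈? elements (support α)))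
    where
    preimage : ∀ i (q : i ∈ elements (support β)) → Dec (i ∈ elements (support α)) →
      Setoid.Carrier (Y.level i (at β i q))
    preimage i q (yes p) = proj₁ (Y.transition-surjective i (≤ᴾ-at {α} {β} h i p q) (z i p))
    preimage i q (no  _) = Y.π i (at β i q) (Y.point₀ i)

    preimage-correct : ∀ i p q (le : Y._≤_ i (at α i p) (at β i q)) d →
      Setoid._≈_ (Y.level i (at α i p)) (Func.to (Y.transition i le) (preimage i q d)) (z i p)
    preimage-correct i p q le (yes p′) with refl ← same (support α) p p′ =
      Setoid.trans (Y.level i (at α i p))
        (transition-irrelevant i le (≤ᴾ-at {α} {β} h i p q) _)
        (proj₂ (Y.transition-surjective i (≤ᴾ-at {α} {β} h i p q) (z i p)))
    preimage-correct i p q le (no ¬p) = contradiction p ¬p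

  transitionᴾ-id : ∀ {α} (h : α ≤ᴾ α) x →
    Setoid._≈_ (levelᴾ α) (Func.to (transitionᴾ {α} {α} h) x) x
  transitionᴾ-id {α} h x i p with q , le ← h i p with refl ← same (support α) p q =
    Y.transition-id i le (x i p)

  transitionᴾ-∘ : ∀ {α β γ} (f : α ≤ᴾ β) (g : β ≤ᴾ γ) (h : α ≤ᴾ γ) x →
    Setoid._≈_ (levelᴾ α)
      (Func.to (transitionᴾ {α} {β} f) (Func.to (transitionᴾ {β} {γ} g) x))
      (Func.to (transitionᴾ {α} {γ} h) x)
  transitionᴾ-∘ {α} {β} {γ} f g h x i p
    with q , le ← f i p
    with r , le′ ← g i q
    with r′ , le″ ← h i p
    with refl ← same (support γ) r r′
    = Y.transition-∘ i le le′ le″ (x i r)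

  -- The product ∏ Y_i, presented by the finite products ∏_{i ∈ K} Y_{i,α_i}.
  product : Presentation
  product = record
    { Index                 = ProductIndex
    ; _≤_                   = _≤ᴾ_
    ; isPreorder            = ≤ᴾ-isPreorder
    ; index₀                = ∅
    ; directed              = ≤ᴾ-directed
    ; level                 = levelᴾ
    ; finite                = λ α → Π-finite _ _ (λ i p → Y.finite i (at α i p))
    ; transition            = λ {α} {β} → transitionᴾ {α} {β}
    ; transition-surjective = λ {α} {β} → transitionᴾ-surjective {α} {β}
    ; transition-id         = λ {α} → transitionᴾ-id {α}
    ; transition-∘          = λ {α} {β} {γ} → transitionᴾ-∘ {α} {β} {γ}
    ; space                 = record
      { Carrier       = ∀ i → Y.Point i
      ; _≈_           = λ x y → ∀ i → Y._≈ₚ_ i (x i) (y i)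
      ; isEquivalence = record
        { refl  = λ i → Setoid.refl (Y.space i)
        ; sym   = λ e i → Setoid.sym (Y.space i) (e i)
        ; trans = λ e e′ i → Setoid.trans (Y.space i) (e i) (e′ i)
        }
      }
    ; proj                  = λ α → record
      { to   = λ x i p → Y.π i (at α i p) (x i)
      ; cong = λ e i p → Func.cong (Y.proj i (at α i p)) (e i)
      }
    ; compatible            = λ h x i p → Y.compatible i (proj₂ (h i p)) (x i)
    ; separated             = λ e i → Y.separated i (λ a → e (single i a) i (here refl))
    ; complete              = λ t t-compatible →
        let pt = λ i → Y.complete i (λ a → t (single i a) i (here refl))
                   (λ {a} {b} le → t-compatible {single i a} {single i b}
                     (λ { _ (here refl) → here refl , le }) i (here refl))
        in (λ i → proj₁ (pt i)) , λ α i p →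
          let open Setoid (Y.level i (at α i p)) using (trans; sym) in
          trans (proj₂ (pt i) (at α i p))
            (trans (sym (t-compatible {single i (at α i p)} {α}
                          (λ { _ (here refl) → p , Y.≤-refl i }) i (here refl)))
                   (Y.transition-id i (Y.≤-refl i) (t α i p)))
    ; point₀                = Y.point₀
    }

  productSubset : (∀ i → Subset (Y i)) → Subset product
  productSubset T = record
    { member   = λ x → ∀ i → member (T i) (x i)
    ; respects = λ e x∈T i → Subset.respects (T i) (e i) (x∈T i)
    }

_//_ : ℕ → ℕ → ℚ
m // zero  = 0ℚ
m // suc n = + m / suc n

module Procounting (em : ExcludedMiddle 0ℓ) (R : ValuedℚAlgebra) where

  open ValuedℚAlgebra R
    using (Carrier; _≈_; _+_; _*_; 0#; 1#; ι; Converges; commutativeRing; +-cong; *-cong)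
  private
    module R = ValuedℚAlgebra R
  open FiniteSum R.+-commutativeMonoid using (sum)

  sumOver : ∀ {A} → Finite A → (Setoid.Carrier A → Carrier) → Carrier
  sumOver fin g = sum (λ i → g (Finite.element fin i))

  card : ∀ {A} → Finite A → (Setoid.Carrier A → Set) → ℕ
  card fin P = length (filter (λ i → em {P (Finite.element fin i)}) (allFin (Finite.size fin)))

  -- The unordered infinite product, as the limit of the net of finite partial products.
  IsProduct : {I : Set} → (I → Carrier) → Carrier → Set
  IsProduct f = Converges _⊑_ (λ K → foldr (λ i → f i *_) 1# (elements K))

  module _ (X : Presentation) where
    open Presentation X

    record LocallyConstant : Set where
      field
        fun             : Point → Carrier
        locallyConstant : ∀ x → ∃ λ α → ∀ y → x ≈[ α ] y → fun x ≈ fun y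

    open LocallyConstant

    combineLC : (_∙_ : Carrier → Carrier → Carrier) →
      (∀ {a b c d} → a ≈ b → c ≈ d → (a ∙ c) ≈ (b ∙ d)) →
      LocallyConstant → LocallyConstant → LocallyConstant
    combineLC _∙_ ∙-cong f g .fun x = fun f x ∙ fun g x
    combineLC _∙_ ∙-cong f g .locallyConstant x
      with α , p ← locallyConstant f x | β , q ← locallyConstant g x
      with γ , α≤γ , β≤γ ← directed α β
      = γ , λ y e → ∙-cong (p y (≈[]-coarsen X α≤γ e)) (q y (≈[]-coarsen X β≤γ e))

    _⊕_ _⊗_ : LocallyConstant → LocallyConstant → LocallyConstant
    _⊕_ = combineLC _+_ +-cong
    _⊗_ = combineLC _*_ *-cong

    _⊙_ : Carrier → LocallyConstant → LocallyConstant
    (r ⊙ f) .fun x = r * fun f x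
    (r ⊙ f) .locallyConstant x with α , p ← locallyConstant f x =
      α , λ y e → R.*-congˡ (p y e)

    pullback : ∀ α → Func (level α) R.setoid → LocallyConstant
    pullback α g .fun x = Func.to g (π α x)
    pullback α g .locallyConstant x = α , λ y e → Func.cong g e

    indicator : (P : Point → Set) →
      ∃ (λ γ → ∀ x y → x ≈[ γ ] y → P x → P y) → LocallyConstant
    indicator P _ .fun x = if does (em {P x}) then 1# else 0#
    indicator P (γ , inv) .locallyConstant x = γ , λ y e →
      agree (inv x y e) (inv y x (Setoid.sym (level γ) e)) em em
      where
      agree : ∀ {A B : Set} → (A → B) → (B → A) → (a : Dec A) (b : Dec B) →
        (if does a then 1# else 0#) ≈ (if does b then 1# else 0#)
      agree f g (yes a) (yes b) = R.refl
      agree f g (yes a) (no ¬b) = contradiction (f a) ¬b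
      agree f g (no ¬a) (yes b) = contradiction (g b) ¬a
      agree f g (no ¬a) (no ¬b) = R.refl

    𝟏 : CompactOpen X → LocallyConstant
    𝟏 U = indicator (CompactOpen.carrier U) (compactOpen-level X U)

    image : Subset X → ∀ α → Setoid.Carrier (level α) → Set
    image S α a = ∃ λ x → member S x × Setoid._≈_ (level α) (π α x) a

    -- The characteristic function of π_α⁻¹(A).
    𝟏-preimage : ∀ α (A : Setoid.Carrier (level α) → Set) →
      (∀ {a b} → Setoid._≈_ (level α) a b → A a → A b) → LocallyConstant
    𝟏-preimage α A resp = indicator (λ x → A (π α x)) (α , λ x y e → resp e)

    record Distribution : Set where
      field
        apply       : LocallyConstant → Carrier
        apply-cong  : ∀ {f g} → (∀ x → fun f x ≈ fun g x) → apply f ≈ apply g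
        apply-⊕     : ∀ f g → apply (f ⊕ g) ≈ apply f + apply g
        apply-⊙     : ∀ r f → apply (r ⊙ f) ≈ r * apply f

    open Distribution

    scale : Carrier → Distribution → Distribution
    scale r μ .apply f        = r * apply μ f
    scale r μ .apply-cong e   = R.*-congˡ (apply-cong μ e)
    scale r μ .apply-⊕ f g    = R.trans (R.*-congˡ (apply-⊕ μ f g)) (R.distribˡ _ _ _)
    scale r μ .apply-⊙ s f    = R.trans (R.*-congˡ (apply-⊙ μ s f))
      (R.trans (R.sym (R.*-assoc _ _ _))
        (R.trans (R.*-congʳ (R.*-comm _ _)) (R.*-assoc _ _ _)))

    _·_ : LocallyConstant → Distribution → Distribution
    (f · μ) .apply g      = apply μ (f ⊗ g)
    (f · μ) .apply-cong e = apply-cong μ (λ x → R.*-congˡ (e x))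
    (f · μ) .apply-⊕ g h  = R.trans (apply-cong μ (λ x → R.distribˡ _ _ _)) (apply-⊕ μ _ _)
    (f · μ) .apply-⊙ r g  = R.trans
      (apply-cong μ (λ x → R.trans (R.sym (R.*-assoc _ _ _))
        (R.trans (R.*-congʳ (R.*-comm _ _)) (R.*-assoc _ _ _))))
      (apply-⊙ μ r (f ⊗ g))

    -- (π_α)_* μ = |X_α|⁻¹ ∑_x δ_x for every α, evaluated at all functions g on X_α.
    IsProcountingWhole : Distribution → Set
    IsProcountingWhole μ = ∀ α (g : Func (level α) R.setoid) →
      apply μ (pullback α g) ≈ ι (1 // ∣level α ∣) * sumOver (finite α) (Func.to g)

    -- For empty S the convention on division by zero gives 0, as required.
    μ̃ : Distribution → Subset X → Index → Distribution
    μ̃ μX S α = scale (ι (∣level α ∣ // card (finite α) (image S α)))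
      (𝟏-preimage α (image S α) image-resp · μX)
      where
      image-resp : ∀ {a b} → Setoid._≈_ (level α) a b → image S α a → image S α b
      image-resp e (x , x∈S , e′) = x , x∈S , Setoid.trans (level α) e′ e

    WeakLimit : (Index → Distribution) → Distribution → Set₁
    WeakLimit ν μ = ∀ U → Converges _≤_ (λ α → apply (ν α) (𝟏 U)) (apply μ (𝟏 U))

    IsProcounting : Subset X → Distribution → Set₁
    IsProcounting S μ = ∃ λ μX → IsProcountingWhole μX × WeakLimit (μ̃ μX S) μ

  module _ {I : Set} (Y : I → Presentation) where
    open Product em Y using (product)

    _IsBox_ : CompactOpen product → (∀ i → CompactOpen (Y i)) → Set
    U IsBox V = ∀ x → CompactOpen.carrier U x ⇔ (∀ i → CompactOpen.carrier (V i) (x i))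

    IsTensorProduct : (∀ i → Distribution (Y i)) → Distribution product → Set₁
    IsTensorProduct μ ν = ∀ (V : ∀ i → CompactOpen (Y i)) U → U IsBox V →
      IsProduct (λ i → Distribution.apply (μ i) (𝟏 (Y i) (V i)))
                (Distribution.apply ν (𝟏 product U))

module Submission where

-- If no T_i is empty, the image of S = ∏ T_i at a level α is the product of the
-- images of the T_i, so counting factorises: if F = ∏ f_i with f_i = 1 off a
-- finite set K of indices, then μ̃_{S,α} (F) = ∏_{i ∈ K} μ̃_{T_i,α_i} (f_i) for
-- all large α, a finite product of convergent nets.  The fibres of the
-- projections are boxes and, by compactness, every locally constant function is
-- a finite combination of their indicators.  Hence μ̃_{S,α} converges on all
-- locally constant functions, to a linear limit because limits in R are unique;
-- completeness of R plays no role.  The same factorisation shows that averaging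
-- over the levels is eventually constant, which gives μ_X.  If some T_i is
-- empty, or U is, then both sides of the product formula vanish.

open import Algebra.Morphism.Structures using (module IsRingHomomorphism)
import Algebra.Properties.AbelianGroup as AbelianGroupProperties
import Algebra.Properties.CommutativeMonoid.Sum as FiniteSum
import Algebra.Properties.Group as GroupProperties
import Algebra.Properties.Ring as RingProperties
import Algebra.Properties.Semiring.Sum as SemiringSum
import Algebra.Solver.Ring.NaturalCoefficients.Default as SemiringSolver
open import Axiom.ExcludedMiddle using (ExcludedMiddle)
open import Data.Bool.Base using (if_then_else_)
open import Data.Fin.Base as Fin using (Fin; remQuot; _↑ˡ_; _↑ʳ_)
import Data.Fin.Properties as Fin
open import Data.Integer.Base as ℤ using (+_)
import Data.Integer.Properties as ℤ
open import Data.List.Base using (List; []; _∷_; _++_; allFin; concat; deduplicate; filter; foldr; length; tabulate)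
open import Data.List.Membership.Propositional using (_∈_; _∉_)
open import Data.List.Membership.Propositional.Properties using (∈-∃++; ∈-deduplicate⁺; ∈-deduplicate⁻)
import Data.List.Properties as List
open import Data.List.Relation.Binary.Permutation.Propositional as Perm using (_↭_; prep; swap; ↭⇒↭ₛ)
open import Data.List.Relation.Binary.Permutation.Propositional.Properties using (∈-resp-↭)
import Data.List.Relation.Binary.Permutation.Propositional.Properties as Perm
import Data.List.Relation.Binary.Permutation.Setoid.Properties as PermSetoid
open import Data.List.Relation.Binary.Subset.Propositional using (_⊆_)
import Data.List.Relation.Unary.All as All
import Data.List.Relation.Unary.All.Properties as All
open import Data.List.Relation.Unary.Any using (Any; here; there)
import Data.List.Relation.Unary.Any.Properties as Any
import Data.List.Relation.Unary.Unique.DecPropositional.Properties as UniqueDec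
open import Data.List.Relation.Unary.Unique.Propositional using (Unique; []; _∷_)
open import Data.Nat.Base as ℕ using (ℕ; zero; suc)
import Data.Nat.Properties as ℕ
open import Data.Product.Base using (∃; _×_; _,_; proj₁; proj₂)
open import Data.Rational.Base as ℚ using (ℚ; 0ℚ; 1ℚ; fromℚᵘ; toℚᵘ)
import Data.Rational.Properties as ℚ
open import Data.Rational.Unnormalised.Base as ℚᵘ using (mkℚᵘ; *≡*)
import Data.Rational.Unnormalised.Properties as ℚᵘ
open import Data.Unit.Base using (⊤; tt)
open import Function.Base using (_∘_)
open import Function.Bundles using (_↣_; Equivalence; Func; Injection; Inverse)
open import Level using (0ℓ)
open import Relation.Binary.Bundles using (Setoid)
open import Relation.Binary.Core using (Rel)
open import Relation.Binary.PropositionalEquality as ≡ using (_≡_; _≢_; refl)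
import Relation.Binary.Reasoning.Setoid as SetoidReasoning
open import Relation.Binary.Structures using (IsPreorder)
open import Relation.Nullary using (¬_; Dec; yes; no; does; contradiction)
open import Defs

-- Compactness of sequential limits

-- The quotients |X_α| / |π_α(S)| are kept out of the argument. A value e is the mean of f over
-- π_α(S) when |π_α(S)| times e is the sum of f over π_α(S). For nonempty S this determines e,
-- because positive integers are invertible in a ℚ-algebra. The values of μ̃_{S,α} and the averages
-- over a level are both means, and means over a product multiply, so each factorisation is a
-- comparison of two means of one function.
--
-- A locally constant function comes with one level for each point, whereas a mean needs one level
-- for the whole space. Compactness supplies it. For the product, compactness rests on an ascending
-- cofinal sequence of indices, built diagonally from the sequences of the Y_i and an injection of
-- the set of coordinates into ℕ.

record AscendingSequence (X : Presentation) : Set where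
  open Presentation X
  field
    chain   : ℕ → Index
    ascends : ∀ n → chain n ≤ chain (suc n)
    cofinal : ∀ α → ∃ λ n → α ≤ chain n

  chain-mono′ : ∀ {m n} → m ℕ.≤′ n → chain m ≤ chain n
  chain-mono′ (ℕ.≤′-reflexive refl) = ≤-refl
  chain-mono′ (ℕ.≤′-step p) = ≤-trans (chain-mono′ p) (ascends _)

  chain-mono : ∀ {m n} → m ℕ.≤ n → chain m ≤ chain n
  chain-mono p = chain-mono′ (ℕ.≤⇒≤′ p)

-- Of the order embedding only monotonicity is kept, since that passes to products: over an empty
-- family any two indices of the product are equivalent, so ℕ does not embed.
ascending : ∀ {X} → CofinalSequence X → AscendingSequence X
ascending c = record
  { chain   = chain
  ; ascends = λ n → Equivalence.to (embedding n (suc n)) (ℕ.n≤1+n n)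
  ; cofinal = cofinal
  }
  where open CofinalSequence c

shift : ∀ {X} → ℕ → AscendingSequence X → AscendingSequence X
shift {X} k c = record
  { chain   = λ n → chain (n ℕ.+ k)
  ; ascends = λ n → ascends (n ℕ.+ k)
  ; cofinal = λ α → let n , p = cofinal α in n , ≤-trans p (chain-mono (ℕ.m≤m+n n k))
  }
  where
  open AscendingSequence c
  open Presentation X

Surjective : Presentation → Set
Surjective X = ∀ α a → ∃ λ x → Setoid._≈_ (level α) (π α x) a
  where open Presentation X

module _ {X : Presentation} (c : AscendingSequence X) where
  open Presentation X
  open AscendingSequence c
  private
    module L α = Setoid (level α)
    tr : ∀ {α β} → α ≤ β → L.Carrier β → L.Carrier α
    tr p = Func.to (transition p)

  module _ (t : ∀ n → L.Carrier (chain n))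
           (compat : ∀ n → L._≈_ (chain n) (tr (ascends n) (t (suc n))) (t n)) where

    thread-step : ∀ {m n} → m ℕ.≤′ n → (q : chain m ≤ chain n) → L._≈_ (chain m) (tr q (t n)) (t m)
    thread-step (ℕ.≤′-reflexive refl) q = transition-id q _
    thread-step {m} (ℕ.≤′-step {n} p) q = L.trans _
      (L.sym _ (transition-∘ (chain-mono′ p) (ascends n) q _))
      (L.trans _ (Func.cong (transition (chain-mono′ p)) (compat n)) (thread-step p _))

    thread-extend : ∀ {α m n} → m ℕ.≤ n → (q : α ≤ chain m) (r : α ≤ chain n) →
      L._≈_ α (tr r (t n)) (tr q (t m))
    thread-extend p q r = L.trans _
      (L.sym _ (transition-∘ q (chain-mono p) r _))
      (Func.cong (transition q) (thread-step (ℕ.≤⇒≤′ p) _))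

    thread-irrelevant : ∀ {α} m n (q : α ≤ chain m) (r : α ≤ chain n) →
      L._≈_ α (tr q (t m)) (tr r (t n))
    thread-irrelevant m n q r = L.trans _
      (L.sym _ (thread-extend (ℕ.m≤m⊔n m n) q s)) (thread-extend (ℕ.m≤n⊔m m n) r s)
      where s = ≤-trans q (chain-mono (ℕ.m≤m⊔n m n))

    -- `complete` asks for a thread over all indices. At α it receives the image of the term at the
    -- chain index chosen above α; two such choices agree, as a comparison at the later one shows.
    thread-point : ∃ λ x → ∀ n → L._≈_ (chain n) (π (chain n) x) (t n)
    thread-point =
      let x , e = complete (λ α → tr (proj₂ (cofinal α)) (t (proj₁ (cofinal α))))
            (λ p → L.trans _
              (transition-∘ p (proj₂ (cofinal _)) (≤-trans p (proj₂ (cofinal _))) _)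
              (thread-irrelevant _ _ _ _))
      in x , λ n → L.trans _ (e (chain n))
           (L.trans _ (thread-irrelevant _ n _ ≤-refl) (transition-id ≤-refl _))

  -- Successive choices form a thread, which a point realises. The conclusion returns a
  -- representative b because P is not assumed to respect the equality of the level.
  dependentChoice : (P : ∀ n → L.Carrier (chain n) → Set) →
    (∀ n a → P n a → ∃ λ b → L._≈_ (chain n) (tr (ascends n) b) a × P (suc n) b) →
    ∀ a → P 0 a → ∃ λ x → L._≈_ (chain 0) (π (chain 0) x) a ×
      (∀ n → ∃ λ b → L._≈_ (chain n) (π (chain n) x) b × P n b)
  dependentChoice P next a pa = x , π≈t 0 , λ n → t n , π≈t n , proj₂ (seq n)
    where
    seq : ∀ n → ∃ (P n)
    seq zero    = a , pa
    seq (suc n) = let b , pb = seq n ; b′ , _ , pb′ = next n b pb in b′ , pb′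
    t : ∀ n → L.Carrier (chain n)
    t n = proj₁ (seq n)
    point = thread-point t (λ n → proj₁ (proj₂ (next n _ (proj₂ (seq n)))))
    x   = proj₁ point
    π≈t = proj₂ point

  -- König's lemma: a property of cylinders that fails on one cylinder fails
  -- on a nested sequence of them, hence near a point.
  könig : ExcludedMiddle 0ℓ → (P : ∀ n → L.Carrier (chain n) → Set) →
    (∀ {n a b} → L._≈_ (chain n) a b → P n a → P n b) →
    (∀ n a → (∀ b → L._≈_ (chain n) (tr (ascends n) b) a → P (suc n) b) → P n a) →
    (∀ x → ∃ λ n → P n (π (chain n) x)) →
    ∀ a → P 0 a
  könig em P resp split local a with em {P 0 a}
  ... | yes pa = pa
  ... | no ¬pa =
    let x , _ , bad = dependentChoice (λ n a → ¬ P n a) next a ¬pa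
        n , good    = local x
        b , e , ¬pb = bad n
    in contradiction (resp e good) ¬pb
    where
    next : ∀ n a → ¬ P n a → ∃ λ b → L._≈_ (chain n) (tr (ascends n) b) a × ¬ P (suc n) b
    next n a ¬pa with em {∃ λ b → L._≈_ (chain n) (tr (ascends n) b) a × ¬ P (suc n) b}
    ... | yes found = found
    ... | no ¬found = contradiction (split n a good) ¬pa
      where
      good : ∀ b → L._≈_ (chain n) (tr (ascends n) b) a → P (suc n) b
      good b e with em {P (suc n) b}
      ... | yes pb = pb
      ... | no ¬pb = contradiction (b , e , ¬pb) ¬found

-- Preimages under the transition maps are chosen one after another along the sequence, starting at
-- an index above α.
π-surjective : ∀ {X} → AscendingSequence X → Surjective X
π-surjective {X} c α a =
  let n , p  = cofinal α
      b , e  = transition-surjective p a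
      x , e′ , _ = dependentChoice (shift n c) (λ _ _ → ⊤)
                    (λ m a _ → let b , e = transition-surjective (ascends (m ℕ.+ n)) a in b , e , tt) b tt
  in x , trans (sym (compatible p x)) (trans (Func.cong (transition p) e′) e)
  where
  open AscendingSequence c
  open Presentation X
  open Setoid (level α) using (sym; trans)

module _ (em : ExcludedMiddle 0ℓ) {X : Presentation} (c : AscendingSequence X) where
  open Presentation X
  open AscendingSequence c
  private
    module L α = Setoid (level α)

  finiteCover : ∀ {A : Set} {m} (Q : Fin m → Point → Set) {V : A → Point → Set} →
    (∀ j → ∃ λ as → ∀ x → Q j x → Any (λ a → V a x) as) →
    ∃ λ as → ∀ x → (∃ λ j → Q j x) → Any (λ a → V a x) as
  finiteCover Q cover = concat (tabulate (λ j → proj₁ (cover j))) ,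
    λ x (j , q) → Any.concat⁺ (Any.tabulate⁺ j (proj₂ (cover j) x q))

  -- König's lemma for the cylinders whose intersection with U has a finite subcover: this property
  -- passes from the finitely many cylinders of the next level to the cylinder that they divide, and
  -- it holds near each point.
  compact-of-level : (U : Point → Set) → (∃ λ γ → ∀ x y → x ≈[ γ ] y → U x → U y) → Compact X U
  compact-of-level U (γ , inv) {A} V V-open V-cover =
    let as , h = finiteCover (λ j x → L._≈_ (chain 0) (π (chain 0) x) (F.from j) × U x)
                   (λ j → let as , h = covered (F.from j) in as , λ x (e , u) → h x e u)
    in as , λ x u → h x (F.to (π (chain 0) x) , L.sym _ (F.strictlyInverseʳ _) , u)
    where
    module F = Inverse (Finite.enumeration (finite (chain 0)))

    Covered : ∀ n → L.Carrier (chain n) → Set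
    Covered n a = ∃ λ as → ∀ x → L._≈_ (chain n) (π (chain n) x) a → U x → Any (λ i → V i x) as

    split : ∀ n a → (∀ b → L._≈_ (chain n) (Func.to (transition (ascends n)) b) a → Covered (suc n) b) →
      Covered n a
    split n a h =
      let as , k = finiteCover Q part
      in as , λ x e u → k x (G.to (π (chain (suc n)) x)
           , L.sym _ (G.strictlyInverseʳ _)
           , L.trans _ (Func.cong (transition (ascends n)) (G.strictlyInverseʳ _))
               (L.trans _ (compatible (ascends n) x) e)
           , u)
      where
      module G = Inverse (Finite.enumeration (finite (chain (suc n))))
      Q : Fin (∣level chain (suc n) ∣) → Point → Set
      Q j x = L._≈_ _ (π (chain (suc n)) x) (G.from j)
            × L._≈_ (chain n) (Func.to (transition (ascends n)) (G.from j)) a × U x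
      part : ∀ j → ∃ λ as → ∀ x → Q j x → Any (λ i → V i x) as
      part j with em {L._≈_ (chain n) (Func.to (transition (ascends n)) (G.from j)) a}
      ... | yes e = let as , k = h (G.from j) e in as , λ x (e′ , _ , u) → k x e′ u
      ... | no ¬e = [] , λ x (_ , e , _) → contradiction e ¬e

    local : ∀ x → ∃ λ n → Covered n (π (chain n) x)
    local x with em {U x}
    ... | yes u =
      let i , v = V-cover x u ; α , k = V-open i x v ; n , p = cofinal α
      in n , i ∷ [] , λ y e _ → here (k y (≈[]-coarsen X p (L.sym _ e)))
    -- Off U the empty list does: a cylinder at level γ or finer lies inside U or misses it.
    ... | no ¬u =
      let n , p = cofinal γ
      in n , [] , λ y e u → contradiction (inv y x (≈[]-coarsen X p e) u) ¬u

    covered = könig c em Covered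
      (λ e (as , k) → as , λ x e′ → k x (L.trans _ e′ (L.sym _ e))) split local

  compactOpen : (U : Point → Set) → (∃ λ γ → ∀ x y → x ≈[ γ ] y → U x → U y) → CompactOpen X
  compactOpen U (γ , inv) = record
    { carrier = U
    ; isOpen  = λ x u → γ , λ y e → inv x y e u
    ; compact = compact-of-level U (γ , inv)
    }

  -- A Lebesgue number: finitely many cylinders on which f is constant cover the space, and γ
  -- refines them all. Points that agree at γ are then both close to one centre z, which is why a
  -- Euclidean relation suffices.
  uniform : {V : Set} (_~_ : V → V → Set) → (∀ {u v w} → u ~ v → u ~ w → v ~ w) →
    (f : Point → V) → (∀ x → ∃ λ α → ∀ y → x ≈[ α ] y → f x ~ f y) →
    ∃ λ γ → ∀ x y → x ≈[ γ ] y → f x ~ f y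
  uniform _~_ eucl f loc = proj₁ bound , λ x y e →
    let z , e′ , p = proj₂ bound (cover x tt)
    in eucl (proj₂ (loc z) x e′) (proj₂ (loc z) y (≈-trans X e′ (≈[]-coarsen X p e)))
    where
    sub = compact-of-level (λ _ → ⊤) (index₀ , λ _ _ _ _ → tt)
      (λ z y → z ≈[ proj₁ (loc z) ] y)
      (λ z y e → _ , λ w → ≈-trans X e) (λ x _ → x , L.refl _)
    cover = proj₂ sub
    bound = upperBound X (λ z → proj₁ (loc z)) (proj₁ sub)

wholeSubset : ∀ X → Subset X
wholeSubset X = record { member = λ _ → ⊤ ; respects = λ _ _ → tt }

-- Convergence of nets in R

module Smallness (R : ValuedℚAlgebra) where

  private module R = ValuedℚAlgebra R
  open R hiding (refl; sym; trans; ring)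

  Small : ℚ → Carrier → Set
  Small ε x = ∣ x ∣ <ʳ ε

  Small-cong : ∀ {ε x y} → x ≈ y → Small ε x → Small ε y
  Small-cong x≈y = proj₂ (∣∣-cong x≈y) _

  Small-0 : ∀ {ε} → 0ℚ ℚ.< ε → Small ε 0#
  Small-0 0<ε = proj₁ (Equivalence.from (∣∣-zero 0#) R.refl) _ 0<ε

  Small-+ : ∀ {δ ε x y} → Small δ x → Small ε y → Small (δ ℚ.+ ε) (x + y)
  Small-+ sx sy = ∣∣-+ _ _ _ (_ , _ , sx , sy , ℚ.≤-refl)

  Small-* : ∀ {δ ε x y} → Small δ x → Small ε y → Small (δ ℚ.* ε) (x * y)
  Small-* sx sy = proj₁ (∣∣-* _ _) _ (_ , _ , sx , sy , ℚ.≤-refl)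

  Small⇒0 : ∀ {x} → (∀ ε → 0ℚ ℚ.< ε → Small ε x) → x ≈ 0#
  Small⇒0 {x} s = Equivalence.to (∣∣-zero x) (s , λ q → ℝ≥0.positive ∣ x ∣)

  Small-≈ : ∀ {ε x y} → 0ℚ ℚ.< ε → x ≈ y → Small ε (x - y)
  Small-≈ {y = y} 0<ε x≈y = Small-cong (R.sym (R.trans (+-congʳ x≈y) (-‿inverseʳ y))) (Small-0 0<ε)

module Nets (R : ValuedℚAlgebra) {D : Set} {_≤_ : Rel D 0ℓ} (isPreorder : IsPreorder _≡_ _≤_)
            (d₀ : D) (directed : ∀ d e → ∃ λ f → d ≤ f × e ≤ f) where

  private module R = ValuedℚAlgebra R
  open R hiding (refl; sym; trans; ring)
  open Smallness R
  open IsPreorder isPreorder using () renaming (trans to ≤-trans; refl to ≤-refl)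
  open SetoidReasoning setoid
  open FiniteSum +-commutativeMonoid using (sum)

  open GroupProperties +-group using (x∙y⁻¹≈ε⇒x≈y; //-rightDividesˡ; //-rightDividesʳ)
  open AbelianGroupProperties +-abelianGroup using (⁻¹-∙-comm; ⁻¹-anti-homo‿-)
  open RingProperties R.ring using (-1*x≈-x)
  open SemiringSolver commutativeSemiring using (solve; _:+_; _:*_; _:=_)

  Eventually : (D → Set) → Set
  Eventually P = ∃ λ d → ∀ e → d ≤ e → P e

  both : ∀ {P Q : D → Set} → Eventually P → Eventually Q → Eventually (λ d → P d × Q d)
  both (d , p) (e , q) with f , d≤f , e≤f ← directed d e =
    f , λ g f≤g → p g (≤-trans d≤f f≤g) , q g (≤-trans e≤f f≤g)

  mapEventually : ∀ {P Q : D → Set} → (∀ {d} → P d → Q d) → Eventually P → Eventually Q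
  mapEventually f (d , p) = d , λ e d≤e → f (p e d≤e)

  Null : (D → Carrier) → Set
  Null x = ∀ ε → 0ℚ ℚ.< ε → Eventually (λ d → Small ε (x d))

  Null-cong : ∀ {x y} → Eventually (λ d → x d ≈ y d) → Null x → Null y
  Null-cong e n ε 0<ε = mapEventually (λ (p , q) → Small-cong p q) (both e (n ε 0<ε))

  Null-+ : ∀ {x y} → Null x → Null y → Null (λ d → x d + y d)
  Null-+ m n ε 0<ε = mapEventually
    (λ (p , q) → ≡.subst (λ r → Small r _) half (Small-+ p q))
    (both (m _ pos) (n _ pos))
    where
    half : ℚ.½ ℚ.* ε ℚ.+ ℚ.½ ℚ.* ε ≡ ε
    half = ≡.trans (≡.sym (ℚ.*-distribʳ-+ ε ℚ.½ ℚ.½)) (ℚ.*-identityˡ ε)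
    pos : 0ℚ ℚ.< ℚ.½ ℚ.* ε
    pos = ℚ.<-respˡ-≡ (ℚ.*-zeroʳ ℚ.½) (ℚ.*-monoʳ-<-pos ℚ.½ 0<ε)

  Null-* : ∀ {x y} → Null x → Null y → Null (λ d → x d * y d)
  Null-* m n ε 0<ε = mapEventually
    (λ (p , q) → ≡.subst (λ r → Small r _) (ℚ.*-identityʳ ε) (Small-* p q))
    (both (m ε 0<ε) (n 1ℚ (ℚ.positive⁻¹ 1ℚ)))

  Null-scale : ∀ {x} c → Null x → Null (λ d → c * x d)
  Null-scale c n ε 0<ε with M , c<M ← ℝ≥0.inhabited ∣ c ∣ = mapEventually
    (λ p → ≡.subst (λ r → Small r _) cancel (Small-* c<M p))
    -- M is any rational above the absolute value of c; it is positive since an upper half contains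
    -- positive rationals only.
    (n (ℚ.1/ M ℚ.* ε) (ℚ.<-respˡ-≡ (ℚ.*-zeroʳ (ℚ.1/ M)) (ℚ.*-monoʳ-<-pos (ℚ.1/ M) 0<ε)))
    where
    instance
      M>0 : ℚ.Positive M
      M>0 = ℚ.positive (ℝ≥0.positive ∣ c ∣ c<M)
      M≢0 : ℚ.NonZero M
      M≢0 = ℚ.pos⇒nonZero M
      1/M>0 : ℚ.Positive (ℚ.1/ M)
      1/M>0 = ℚ.1/pos⇒pos M
    cancel : M ℚ.* (ℚ.1/ M ℚ.* ε) ≡ ε
    cancel = ≡.trans (≡.sym (ℚ.*-assoc M (ℚ.1/ M) ε))
      (≡.trans (≡.cong (ℚ._* ε) (ℚ.*-inverseʳ M)) (ℚ.*-identityˡ ε))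

  infix 4 _⟶_
  _⟶_ : (D → Carrier) → Carrier → Set
  _⟶_ = Converges _≤_

  always : ∀ {P : D → Set} → (∀ d → P d) → Eventually P
  always p = d₀ , λ d _ → p d

  ⟶-cong : ∀ {x y a b} → Eventually (λ d → x d ≈ y d) → a ≈ b → x ⟶ a → y ⟶ b
  ⟶-cong e a≈b = Null-cong (mapEventually (λ p → +-cong p (-‿cong a≈b)) e)

  ⟶-const : ∀ a → (λ _ → a) ⟶ a
  ⟶-const a ε 0<ε = always {λ _ → Small ε (a - a)}
    (λ _ → Small-≈ 0<ε R.refl)

  ⟶-eventually : ∀ {x a} → Eventually (λ d → x d ≈ a) → x ⟶ a
  ⟶-eventually {a = a} e = ⟶-cong (mapEventually (R.sym) e) (R.refl) (⟶-const a)

  ⟶-+ : ∀ {x y a b} → x ⟶ a → y ⟶ b → (λ d → x d + y d) ⟶ a + b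
  ⟶-+ m n = Null-cong (always (λ d → regroup _ _ _ _)) (Null-+ m n)
    where
    regroup : ∀ x y a b → (x - a) + (y - b) ≈ (x + y) - (a + b)
    regroup x y a b = R.trans
      (solve 4 (λ x y a b → (x :+ a) :+ (y :+ b) := (x :+ y) :+ (a :+ b)) R.refl x y (- a) (- b))
      (+-congˡ (⁻¹-∙-comm a b))

  -- Expanding x y - a b in the differences x - a and y - b leaves a product of null nets and
  -- multiples of null nets by the fixed limits, so that neither net has to be bounded.
  ⟶-* : ∀ {x y a b} → x ⟶ a → y ⟶ b → (λ d → x d * y d) ⟶ a * b
  ⟶-* {a = a} {b} m n = Null-cong (always (λ d → expand _ _ _ _))
    (Null-+ (Null-* m n) (Null-+ (Null-scale a n) (Null-scale b m)))
    where
    expand : ∀ x y a b → (x - a) * (y - b) + (a * (y - b) + b * (x - a)) ≈ x * y - a * b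
    expand x y a b = begin
      u * v + (a * v + b * u)                    ≈⟨ //-rightDividesʳ (a * b) _ ⟨
      (u * v + (a * v + b * u)) + a * b - a * b  ≈⟨ +-congʳ (solve 4 (λ u v a b →
        (u :* v :+ (a :* v :+ b :* u)) :+ a :* b := (u :+ a) :* (v :+ b)) R.refl u v a b) ⟩
      (u + a) * (v + b) - a * b                  ≈⟨ +-congʳ
        (*-cong (//-rightDividesˡ a x) (//-rightDividesˡ b y)) ⟩
      x * y - a * b                              ∎
      where
      u = x - a
      v = y - b

  -- The constant a - b is a sum of two null nets, hence smaller than every ε, and only 0 has
  -- absolute value 0.
  ⟶-unique : ∀ {x a b} → x ⟶ a → x ⟶ b → a ≈ b
  ⟶-unique {a = a} {b} m n = x∙y⁻¹≈ε⇒x≈y a b (Small⇒0 (λ ε 0<ε →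
    let d , p = Null-cong (always (λ d → cancel _)) (Null-+ (Null-scale (- 1#) m) n) ε 0<ε
    in p d ≤-refl))
    where
    cancel : ∀ x → - 1# * (x - a) + (x - b) ≈ a - b
    cancel x = begin
      - 1# * (x - a) + (x - b)  ≈⟨ +-congʳ (R.trans (-1*x≈-x _) (⁻¹-anti-homo‿- x a)) ⟩
      (a - x) + (x - b)         ≈⟨ +-assoc _ x (- b) ⟨
      (a - x) + x - b           ≈⟨ +-congʳ (//-rightDividesˡ x a) ⟩
      a - b                     ∎

  ⟶-sum : ∀ {n} {x : Fin n → D → Carrier} {a} → (∀ j → x j ⟶ a j) →
    (λ d → sum (λ j → x j d)) ⟶ sum a
  ⟶-sum {zero}  h = ⟶-const 0#
  ⟶-sum {suc n} h = ⟶-+ (h Fin.zero) (⟶-sum (λ j → h (Fin.suc j)))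

  ⟶-∏ : ∀ {I : Set} (K : List I) {x : I → D → Carrier} {a : I → Carrier} → (∀ i → i ∈ K → x i ⟶ a i) →
    (λ d → foldr (λ i → x i d *_) 1# K) ⟶ foldr (λ i → a i *_) 1# K
  ⟶-∏ []          h = ⟶-const 1#
  ⟶-∏ (k ∷ K) {x} {a} h = ⟶-* (h k (here refl)) (⟶-∏ K {x} {a} (λ i p → h i (there p)))

-- Counting in finite sets

listBound : ∀ {I : Set} (K : List I) (f : ∀ i → i ∈ K → ℕ) → ∃ λ n → ∀ i p → f i p ℕ.≤ n
listBound []      f = 0 , λ _ ()
listBound (k ∷ K) f with n , h ← listBound K (λ i p → f i (there p)) =
  f k (here refl) ℕ.⊔ n , λ
    { _ (here refl) → ℕ.m≤m⊔n _ _
    ; i (there p)   → ℕ.≤-trans (h i p) (ℕ.m≤n⊔m (f k (here refl)) n)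
    }

-- Fractions of natural numbers

module Rationals where
  -- Identities between fractions are checked on unnormalised rationals, where they are identities
  -- between integers, and carried over by `fromℚᵘ`.
  fromℚᵘ-* : ∀ p q → fromℚᵘ (p ℚᵘ.* q) ≡ fromℚᵘ p ℚ.* fromℚᵘ q
  fromℚᵘ-* p q = ℚ.toℚᵘ-injective (begin
    toℚᵘ (fromℚᵘ (p ℚᵘ.* q))                 ≈⟨ ℚ.toℚᵘ-fromℚᵘ _ ⟩
    p ℚᵘ.* q                                 ≈⟨ ℚᵘ.*-cong (ℚ.toℚᵘ-fromℚᵘ p) (ℚ.toℚᵘ-fromℚᵘ q) ⟨
    toℚᵘ (fromℚᵘ p) ℚᵘ.* toℚᵘ (fromℚᵘ q)     ≈⟨ ℚ.toℚᵘ-homo-* (fromℚᵘ p) (fromℚᵘ q) ⟨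
    toℚᵘ (fromℚᵘ p ℚ.* fromℚᵘ q)             ∎)
    where open SetoidReasoning ℚᵘ.≃-setoid

  fromℚᵘ-+ : ∀ p q → fromℚᵘ (p ℚᵘ.+ q) ≡ fromℚᵘ p ℚ.+ fromℚᵘ q
  fromℚᵘ-+ p q = ℚ.toℚᵘ-injective (begin
    toℚᵘ (fromℚᵘ (p ℚᵘ.+ q))                 ≈⟨ ℚ.toℚᵘ-fromℚᵘ _ ⟩
    p ℚᵘ.+ q                                 ≈⟨ ℚᵘ.+-cong (ℚ.toℚᵘ-fromℚᵘ p) (ℚ.toℚᵘ-fromℚᵘ q) ⟨
    toℚᵘ (fromℚᵘ p) ℚᵘ.+ toℚᵘ (fromℚᵘ q)     ≈⟨ ℚ.toℚᵘ-homo-+ (fromℚᵘ p) (fromℚᵘ q) ⟨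
    toℚᵘ (fromℚᵘ p ℚ.+ fromℚᵘ q)             ∎)
    where open SetoidReasoning ℚᵘ.≃-setoid

  suc-//1 : ∀ n → suc n // 1 ≡ 1ℚ ℚ.+ n // 1
  suc-//1 n = ≡.trans
    (ℚ.fromℚᵘ-cong {mkℚᵘ (+ suc n) 0} {mkℚᵘ (+ 1) 0 ℚᵘ.+ mkℚᵘ (+ n) 0}
      (*≡* (≡.cong (ℤ._* + 1) (≡.cong (λ k → + 1 ℤ.+ k) (≡.sym (ℤ.*-identityʳ (+ n)))))))
    (fromℚᵘ-+ (mkℚᵘ (+ 1) 0) (mkℚᵘ (+ n) 0))

  //-split : ∀ m n → m // n ≡ (m // 1) ℚ.* (1 // n)
  -- With m // 0 = 0 both sides vanish.
  //-split m zero = ≡.sym (ℚ.*-zeroʳ (m // 1))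
  //-split m (suc n) = ≡.trans
    (ℚ.fromℚᵘ-cong {mkℚᵘ (+ m) n} {mkℚᵘ (+ m) 0 ℚᵘ.* mkℚᵘ (+ 1) n}
      (*≡* (≡.cong₂ ℤ._*_ (≡.sym (ℤ.*-identityʳ (+ m))) (≡.cong (λ k → + suc k) (ℕ.+-identityʳ n)))))
    (fromℚᵘ-* (mkℚᵘ (+ m) 0) (mkℚᵘ (+ 1) n))

  //-inverse : ∀ n → (suc n // 1) ℚ.* (1 // suc n) ≡ 1ℚ
  //-inverse n = ≡.trans (≡.sym (//-split (suc n) (suc n)))
    (ℚ.fromℚᵘ-cong {mkℚᵘ (+ suc n) n} {mkℚᵘ (+ 1) 0}
      (*≡* (ℤ.*-comm (+ suc n) (+ 1))))

open Rationals

-- Indicators, finite products and finite sums in R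

module ProcountingTheory (em : ExcludedMiddle 0ℓ) (R : ValuedℚAlgebra) where

  open Procounting em R
  open LocallyConstant
  open Distribution
  open Smallness R
  private module R = ValuedℚAlgebra R
  open R using (Carrier; _≈_; _+_; _*_; -_; 0#; 1#; ι; *-cong; *-congˡ; *-congʳ; +-cong; +-congˡ; +-congʳ)
  open SetoidReasoning R.setoid
  open FiniteSum R.+-commutativeMonoid using (sum; sum-cong-≋; sum-replicate-zero; ∑-distrib-+)
  open SemiringSum R.semiring using (*-distribˡ-sum)
  open SemiringSolver R.commutativeSemiring using (solve; _:+_; _:*_; _:=_)
  open GroupProperties R.+-group using (//-rightDividesˡ; //-rightDividesʳ)
  open RingProperties R.ring using (-‿distribˡ-*)
  open IsRingHomomorphism R.ι-isHomomorphism
    using () renaming (⟦⟧-cong to ι-cong; +-homo to ι-+; *-homo to ι-*; 0#-homo to ι-0; 1#-homo to ι-1)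

  -- Written exactly like the values of `indicator`, so that these unfold to brackets.
  ⟦_⟧ : Set → Carrier
  ⟦ P ⟧ = if does (em {P}) then 1# else 0#

  ⟦⟧-true : ∀ {P} → P → ⟦ P ⟧ ≈ 1#
  ⟦⟧-true {P} p with em {P}
  ... | yes _ = R.refl
  ... | no ¬p = contradiction p ¬p

  ⟦⟧-false : ∀ {P} → ¬ P → ⟦ P ⟧ ≈ 0#
  ⟦⟧-false {P} ¬p with em {P}
  ... | yes p = contradiction p ¬p
  ... | no _  = R.refl

  ⟦⟧-⇔ : ∀ {P Q} → (P → Q) → (Q → P) → ⟦ P ⟧ ≈ ⟦ Q ⟧
  ⟦⟧-⇔ {P} {Q} f g with em {Q}
  ... | yes q = ⟦⟧-true (g q)
  ... | no ¬q = ⟦⟧-false (¬q ∘ f)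

  module _ {I : Set} where
    ∏ : List I → (I → Carrier) → Carrier
    ∏ K f = foldr (λ i → f i *_) 1# K

    -- Factors may depend on the proof of membership, as the components `at α i p` of a product
    -- index do.
    ∏ᵈ : (K : List I) → (∀ i → i ∈ K → Carrier) → Carrier
    ∏ᵈ []      f = 1#
    ∏ᵈ (k ∷ K) f = f k (here refl) * ∏ᵈ K (λ i p → f i (there p))

    ∏ᵈ-cong : ∀ K {f g : ∀ i → i ∈ K → Carrier} → (∀ i p → f i p ≈ g i p) → ∏ᵈ K f ≈ ∏ᵈ K g
    ∏ᵈ-cong []      e = R.refl
    ∏ᵈ-cong (k ∷ K) e = *-cong (e k (here refl)) (∏ᵈ-cong K (λ i p → e i (there p)))

    ∏ᵈ-∏ : ∀ K (f : ∀ i → i ∈ K → Carrier) (g : I → Carrier) →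
      (∀ i p → f i p ≈ g i) → ∏ᵈ K f ≈ ∏ K g
    ∏ᵈ-∏ []      f g e = R.refl
    ∏ᵈ-∏ (k ∷ K) f g e = *-cong (e k (here refl)) (∏ᵈ-∏ K _ g (λ i p → e i (there p)))

    ∏-cong : ∀ K {f g : I → Carrier} → (∀ i → i ∈ K → f i ≈ g i) → ∏ K f ≈ ∏ K g
    ∏-cong []      e = R.refl
    ∏-cong (k ∷ K) e = *-cong (e k (here refl)) (∏-cong K (λ i p → e i (there p)))

    ∏ᵈ-* : ∀ K (f g : ∀ i → i ∈ K → Carrier) →
      ∏ᵈ K f * ∏ᵈ K g ≈ ∏ᵈ K (λ i p → f i p * g i p)
    ∏ᵈ-* []      f g = R.*-identityˡ 1#
    ∏ᵈ-* (k ∷ K) f g = R.trans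
      (solve 4 (λ a b c d → (a :* b) :* (c :* d) := (a :* c) :* (b :* d)) R.refl _ _ _ _)
      (*-congˡ (∏ᵈ-* K _ _))

    ∏ᵈ-⟦⟧ : ∀ K (P : ∀ i → i ∈ K → Set) → ⟦ (∀ i p → P i p) ⟧ ≈ ∏ᵈ K (λ i p → ⟦ P i p ⟧)
    ∏ᵈ-⟦⟧ []      P = ⟦⟧-true (λ _ ())
    ∏ᵈ-⟦⟧ (k ∷ K) P with em {P k (here refl)}
    ... | yes p = R.trans
      (⟦⟧-⇔ (λ h i q → h i (there q)) (λ { h i (here refl) → p ; h i (there q) → h i q }))
      (R.trans (∏ᵈ-⟦⟧ K _) (R.sym (R.*-identityˡ _)))
    ... | no ¬p = R.trans (⟦⟧-false (λ h → ¬p (h k (here refl)))) (R.sym (R.zeroˡ _))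

    ∏-zero : ∀ {K i} (f : I → Carrier) → i ∈ K → f i ≈ 0# → ∏ K f ≈ 0#
    ∏-zero f (here refl) e = R.trans (*-congʳ e) (R.zeroˡ _)
    ∏-zero f (there p)   e = R.trans (*-congˡ (∏-zero f p e)) (R.zeroʳ _)

    ∏-one : ∀ K (f : I → Carrier) → (∀ i → i ∈ K → f i ≈ 1#) → ∏ K f ≈ 1#
    ∏-one []      f e = R.refl
    ∏-one (k ∷ K) f e = R.trans
      (*-cong (e k (here refl)) (∏-one K f (λ i p → e i (there p)))) (R.*-identityˡ 1#)

    ∏-↭ : ∀ {K L} (f : I → Carrier) → K ↭ L → ∏ K f ≈ ∏ L f
    ∏-↭ f Perm.refl      = R.refl
    ∏-↭ f (prep x p)     = *-congˡ (∏-↭ f p)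
    ∏-↭ f (swap x y p)   = R.trans
      (solve 3 (λ a b c → a :* (b :* c) := b :* (a :* c)) R.refl _ _ _)
      (*-congˡ (*-congˡ (∏-↭ f p)))
    ∏-↭ f (Perm.trans p q) = R.trans (∏-↭ f p) (∏-↭ f q)

    -- The elements of K are moved to the front of L and split off one by one; what is left of L
    -- lies outside K and contributes ones.
    ∏-⊆ : ∀ {K L} (f : I → Carrier) → Unique K → Unique L → K ⊆ L →
      (∀ i → i ∈ L → i ∉ K → f i ≈ 1#) → ∏ L f ≈ ∏ K f
    ∏-⊆ {[]}    {L} f _ _ _ e = ∏-one L f (λ i p → e i p λ ())
    ∏-⊆ {k ∷ K} {L} f (k∉K ∷ uK) uL K⊆L e
      with L₁ , L₂ , refl ← ∈-∃++ (K⊆L (here refl))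
      with perm ← Perm.shift k L₁ L₂
      with k∉L′ ∷ uL′ ← PermSetoid.Unique-resp-↭ (≡.setoid I) (↭⇒↭ₛ perm) uL = R.trans (∏-↭ f perm)
        (*-congˡ (∏-⊆ f uK uL′ K⊆L′
          (λ i p i∉K → e i (∈-resp-↭ (Perm.↭-sym perm) (there p))
            λ { (here refl) → All.lookup k∉L′ p refl ; (there q) → i∉K q })))
      where
      K⊆L′ : K ⊆ L₁ ++ L₂
      K⊆L′ p with ∈-resp-↭ perm (K⊆L (there p))
      ... | here refl = contradiction refl (All.lookup k∉K p)
      ... | there q   = q

  sum-zero : ∀ {n} (f : Fin n → Carrier) → (∀ j → f j ≈ 0#) → sum f ≈ 0#
  sum-zero {n} f e = R.trans (sum-cong-≋ e) (sum-replicate-zero n)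

  sum-single : ∀ {n} (f : Fin n → Carrier) i → (∀ j → j ≢ i → f j ≈ 0#) → sum f ≈ f i
  sum-single f Fin.zero    e = R.trans (+-congˡ (sum-zero _ (λ j → e (Fin.suc j) λ ()))) (R.+-identityʳ _)
  sum-single f (Fin.suc i) e = R.trans
    (+-cong (e Fin.zero λ ()) (sum-single (f ∘ Fin.suc) i (λ j ne → e (Fin.suc j) (ne ∘ Fin.suc-injective))))
    (R.+-identityˡ _)

  sum-++ : ∀ m {n} (f : Fin (m ℕ.+ n) → Carrier) →
    sum f ≈ sum (λ i → f (i ↑ˡ n)) + sum (λ j → f (m ↑ʳ j))
  sum-++ zero    f = R.sym (R.+-identityˡ _)
  sum-++ (suc m) f = R.trans (+-congˡ (sum-++ m (f ∘ Fin.suc))) (R.sym (R.+-assoc _ _ _))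

  -- `remQuot` enumerates pairs lexicographically: the first n of them have first coordinate zero,
  -- the others repeat the enumeration for m.
  sum-remQuot : ∀ {m} n (f : Fin m → Carrier) (g : Fin n → Carrier) →
    sum (λ j → f (proj₁ (remQuot {m} n j)) * g (proj₂ (remQuot {m} n j))) ≈ sum f * sum g
  sum-remQuot {zero}  n f g = R.sym (R.zeroˡ _)
  sum-remQuot {suc m} n f g = begin
    sum h                                                         ≈⟨ sum-++ n h ⟩
    sum (λ i → h (i ↑ˡ (m ℕ.* n))) + sum (λ j → h (n ↑ʳ j))       ≈⟨ +-cong
      (sum-cong-≋ (λ i → R.reflexive (≡.cong h′ (Fin.remQuot-combine {suc m} {n} Fin.zero i))))
      (sum-cong-≋ (λ j → R.reflexive (≡.cong h′ (remQuot-↑ʳ j)))) ⟩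
    sum (λ i → f Fin.zero * g i) + sum (λ j → f (Fin.suc (proj₁ (remQuot {m} n j))) * g (proj₂ (remQuot {m} n j)))
      ≈⟨ +-cong (R.sym (*-distribˡ-sum (f Fin.zero) g)) (sum-remQuot {m} n (f ∘ Fin.suc) g) ⟩
    f Fin.zero * sum g + sum (f ∘ Fin.suc) * sum g                ≈⟨ R.distribʳ _ _ _ ⟨
    sum f * sum g                                                 ∎
    where
    h′ : Fin (suc m) × Fin n → Carrier
    h′ (i , j) = f i * g j
    h : Fin (n ℕ.+ m ℕ.* n) → Carrier
    h j = h′ (remQuot {suc m} n j)
    remQuot-↑ʳ : ∀ j → remQuot {suc m} n (n ↑ʳ j) ≡ (Fin.suc (proj₁ (remQuot {m} n j)) , proj₂ (remQuot {m} n j))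
    remQuot-↑ʳ j rewrite Fin.splitAt-↑ʳ n (m ℕ.* n) j = refl

  sumOver-cong : ∀ {A} (fin : Finite A) {f g : Setoid.Carrier A → Carrier} →
    (∀ a → f a ≈ g a) → sumOver fin f ≈ sumOver fin g
  sumOver-cong fin e = sum-cong-≋ (λ j → e (Finite.element fin j))

  private
    ι-suc : ∀ n → ι (suc n // 1) ≈ 1# + ι (n // 1)
    ι-suc n = R.trans (ι-cong (suc-//1 n)) (R.trans (ι-+ 1ℚ (n // 1)) (+-congʳ ι-1))

  sum-⟦⟧ : ∀ {m n} (P : Fin m → Set) (f : Fin n → Fin m) →
    sum (λ j → ⟦ P (f j) ⟧) ≈ ι (length (filter (λ i → em {P i}) (tabulate f)) // 1)
  sum-⟦⟧ {n = zero}  P f = R.sym ι-0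
  sum-⟦⟧ {n = suc n} P f with em {P (f Fin.zero)}
  ... | yes _ = R.trans (+-congˡ (sum-⟦⟧ P (f ∘ Fin.suc)))
    (R.sym (ι-suc (length (filter (λ i → em {P i}) (tabulate (f ∘ Fin.suc))))))
  ... | no  _ = R.trans (R.+-identityˡ _) (sum-⟦⟧ P (f ∘ Fin.suc))

  card-sum : ∀ {A} (fin : Finite A) (P : Setoid.Carrier A → Set) →
    sumOver fin (λ a → ⟦ P a ⟧) ≈ ι (card fin P // 1)
  card-sum fin P = sum-⟦⟧ (λ i → P (Finite.element fin i)) (λ i → i)

  module _ {A} (fin : Finite A) (P : Setoid.Carrier A → Set) where
    card-nonempty : ∀ i → P (Finite.element fin i) → 0 ℕ.< card fin P
    card-nonempty i p = List.filter-some _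
      (Any.tabulate⁺ {P = λ i → P (Finite.element fin i)} i p)

    card-empty : (∀ a → ¬ P a) → card fin P ≡ 0
    card-empty ¬p = ≡.cong length (List.filter-none (λ i → em {P (Finite.element fin i)})
      {allFin (Finite.size fin)} (All.tabulate⁺ (λ i → ¬p _)))

    card-full : (∀ a → P a) → card fin P ≡ Finite.size fin
    card-full p = ≡.trans
      (≡.cong length (List.filter-all (λ i → em {P (Finite.element fin i)})
        {allFin (Finite.size fin)} (All.tabulate⁺ (λ i → p _))))
      (List.length-tabulate (λ i → i))

  ι-inverse : ∀ {n} → 0 ℕ.< n → ι (n // 1) * ι (1 // n) ≈ 1#
  ι-inverse {suc n} _ = R.trans (R.sym (ι-* _ _)) (R.trans (ι-cong (//-inverse n)) ι-1)

  ι-split : ∀ m n → ι (m // n) ≈ ι (m // 1) * ι (1 // n)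
  ι-split m n = R.trans (ι-cong (//-split m n)) (ι-* _ _)

  -- For m = |X_α| and n = |π_α(S)| the three factors are the cardinality in `IsMean`, the scaling
  -- in `μ̃` and the weight of a point under μ_X.
  ι-// : ∀ {m n} → 0 ℕ.< m → 0 ℕ.< n → ι (n // 1) * (ι (m // n) * ι (1 // m)) ≈ 1#
  ι-// {m} {n} 0<m 0<n = begin
    ι (n // 1) * (ι (m // n) * ι (1 // m))                      ≈⟨ *-congˡ (*-congʳ (ι-split m n)) ⟩
    ι (n // 1) * (ι (m // 1) * ι (1 // n) * ι (1 // m))         ≈⟨
      solve 4 (λ a b c d → a :* (b :* c :* d) := (a :* c) :* (b :* d)) R.refl _ _ _ _ ⟩
    (ι (n // 1) * ι (1 // n)) * (ι (m // 1) * ι (1 // m))       ≈⟨ *-cong (ι-inverse 0<n) (ι-inverse 0<m) ⟩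
    1# * 1#                                                     ≈⟨ R.*-identityˡ 1# ⟩
    1#                                                          ∎

  ι-cancel : ∀ {n x y} → 0 ℕ.< n → ι (n // 1) * x ≈ ι (n // 1) * y → x ≈ y
  ι-cancel {n} {x} {y} 0<n e = begin
    x                              ≈⟨ unit x ⟨
    ι (1 // n) * (ι (n // 1) * x)  ≈⟨ *-congˡ e ⟩
    ι (1 // n) * (ι (n // 1) * y)  ≈⟨ unit y ⟩
    y                              ∎
    where
    unit : ∀ z → ι (1 // n) * (ι (n // 1) * z) ≈ z
    unit z = R.trans (R.sym (R.*-assoc _ _ _))
      (R.trans (*-congʳ (R.trans (R.*-comm _ _) (ι-inverse 0<n))) (R.*-identityˡ z))

  -- Distributions and means

  module _ {X : Presentation} where
    open Presentation X

    FactorsAt : LocallyConstant X → Index → Set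
    FactorsAt f α = ∀ x y → x ≈[ α ] y → fun f x ≈ fun f y

    FactorsAt-mono : ∀ {f α β} → α ≤ β → FactorsAt f α → FactorsAt f β
    FactorsAt-mono p h x y e = h x y (≈[]-coarsen X p e)

    fibre : ∀ α → Setoid.Carrier (level α) → LocallyConstant X
    fibre α a = indicator X (λ x → Setoid._≈_ (level α) (π α x) a)
      (α , λ x y e e′ → Setoid.trans (level α) (Setoid.sym (level α) e) e′)

    apply-0 : ∀ ν {f} → (∀ x → fun f x ≈ 0#) → apply ν f ≈ 0#
    apply-0 ν {f} e = begin
      apply ν f              ≈⟨ apply-cong ν (λ x → R.trans (e x) (R.sym (R.zeroˡ _))) ⟩
      apply ν (_⊙_ X 0# f)   ≈⟨ apply-⊙ ν 0# f ⟩
      0# * apply ν f         ≈⟨ R.zeroˡ _ ⟩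
      0#                     ∎

    -- Each step subtracts the first term from f and applies the induction to the difference, so the
    -- partial sums need not be built as locally constant functions.
    apply-sum : ∀ ν {n} (r : Fin n → Carrier) (g : Fin n → LocallyConstant X) f →
      (∀ x → fun f x ≈ sum (λ j → r j * fun (g j) x)) → apply ν f ≈ sum (λ j → r j * apply ν (g j))
    apply-sum ν {zero}  r g f e = apply-0 ν e
    apply-sum ν {suc n} r g f e = begin
      apply ν f                          ≈⟨ apply-cong ν {f} {_⊕_ X head rest} (λ x → R.sym (R.trans (R.+-comm _ _) (R.trans
                                              (+-congʳ (+-congˡ (R.sym (-‿distribˡ-* _ _)))) (//-rightDividesˡ _ _)))) ⟩
      apply ν (_⊕_ X head rest)          ≈⟨ apply-⊕ ν head rest ⟩
      apply ν head + apply ν rest        ≈⟨ +-cong (apply-⊙ ν _ _) (apply-sum ν (r ∘ Fin.suc) (g ∘ Fin.suc) rest rest≈) ⟩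
      sum (λ j → r j * apply ν (g j))    ∎
      where
      head rest : LocallyConstant X
      head = _⊙_ X (r Fin.zero) (g Fin.zero)
      rest = _⊕_ X f (_⊙_ X (- r Fin.zero) (g Fin.zero))
      rest≈ : ∀ x → fun rest x ≈ sum (λ j → r (Fin.suc j) * fun (g (Fin.suc j)) x)
      rest≈ x = R.trans
        (+-cong (e x) (R.sym (-‿distribˡ-* _ _)))
        (R.trans (R.+-congʳ (R.+-comm _ _)) (//-rightDividesʳ _ _))

    module _ (lift : Surjective X) where

      section : ∀ α → Setoid.Carrier (level α) → Point
      section α a = proj₁ (lift α a)

      -- On each fibre over level γ the function f has the value at the chosen lift. Questions about
      -- f are thereby reduced to finitely many fibres.
      apply-fibres : ∀ ν f γ → FactorsAt f γ → apply ν f ≈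
        sum (λ j → fun f (section γ (Finite.element (finite γ) j)) * apply ν (fibre γ (Finite.element (finite γ) j)))
      apply-fibres ν f γ h = apply-sum ν _ (λ j → fibre γ (F.from j)) f (λ x → R.sym (begin
        sum (λ j → fun f (section γ (F.from j)) * ⟦ L._≈_ (π γ x) (F.from j) ⟧)
          ≈⟨ sum-single _ (F.to (π γ x)) (λ j ne → R.trans
               (*-congˡ (⟦⟧-false (λ e → ne (≡.sym (F.inverseˡ e))))) (R.zeroʳ _)) ⟩
        fun f (section γ (F.from (F.to (π γ x)))) * ⟦ L._≈_ (π γ x) (F.from (F.to (π γ x))) ⟧
          ≈⟨ *-cong (h _ x (L.trans (proj₂ (lift γ _)) (F.strictlyInverseʳ _)))
                    (⟦⟧-true (L.sym (F.strictlyInverseʳ _))) ⟩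
        fun f x * 1#  ≈⟨ R.*-identityʳ _ ⟩
        fun f x       ∎))
        where
        module F = Inverse (Finite.enumeration (finite γ))
        module L = Setoid (level γ)

      count : Subset X → Index → Carrier
      count S α = sumOver (finite α) (λ a → ⟦ image X S α a ⟧)

      total : Subset X → ∀ α → LocallyConstant X → Carrier
      total S α f = sumOver (finite α) (λ a → ⟦ image X S α a ⟧ * fun f (section α a))

      -- The mean of f over π_α(S), with the cardinality multiplied out so that no quotient occurs.
      IsMean : Subset X → ∀ α → LocallyConstant X → Carrier → Set
      IsMean S α f e = count S α * e ≈ total S α f

      module _ {S : Subset X} (s : ∃ (Subset.member S)) where

        card-positive : ∀ α → 0 ℕ.< card (finite α) (image X S α)
        card-positive α = card-nonempty (finite α) (image X S α) (F.to (π α (proj₁ s)))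
          (proj₁ s , proj₂ s , Setoid.sym (level α) (F.strictlyInverseʳ _))
          where module F = Inverse (Finite.enumeration (finite α))

        -- The cardinality of π_α(S) is positive, hence cancels in a ℚ-algebra. The comparisons of
        -- averages and of values of `μ̃` below go through this lemma.
        mean-unique : ∀ {α f d e} → IsMean S α f d → IsMean S α f e → d ≈ e
        mean-unique {α} m n = ι-cancel (card-positive α)
          (R.trans (*-congʳ (R.sym c)) (R.trans m (R.trans (R.sym n) (*-congʳ c))))
          where c = card-sum (finite α) (image X S α)

        mean-one : ∀ {α f} → (∀ x → fun f x ≈ 1#) → IsMean S α f 1#
        mean-one {α} {f} e = R.trans (R.*-identityʳ _)
          (sumOver-cong (finite α) {g = λ a → ⟦ image X S α a ⟧ * fun f (section α a)}
            (λ a → R.sym (R.trans (*-congˡ (e (section α a))) (R.*-identityʳ _))))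

      size-positive : ∀ α → 0 ℕ.< ∣level α ∣
      size-positive α = ℕ.>-nonZero⁻¹ _ {{Fin.nonZeroIndex (Inverse.to (Finite.enumeration (finite α)) (π α point₀))}}

      average : ∀ α → LocallyConstant X → Carrier
      average α f = ι (1 // ∣level α ∣) * sumOver (finite α) (λ a → fun f (section α a))

      average-mean : ∀ {S} → (∀ x → Subset.member S x) → ∀ α f → IsMean S α f (average α f)
      average-mean {S} full α f = begin
        count S α * average α f                             ≈⟨ R.*-assoc _ _ _ ⟨
        (count S α * ι (1 // ∣level α ∣)) * sumf            ≈⟨ *-congʳ (*-congʳ (R.trans (card-sum (finite α) (image X S α))
                                                                 (R.reflexive (≡.cong (λ k → ι (k // 1)) (card-full (finite α) (image X S α) in-image))))) ⟩
        (ι (∣level α ∣ // 1) * ι (1 // ∣level α ∣)) * sumf  ≈⟨ *-congʳ (ι-inverse (size-positive α)) ⟩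
        1# * sumf                                           ≈⟨ R.*-identityˡ _ ⟩
        sumf                                                ≈⟨ sumOver-cong (finite α)
                                                                 {λ a → ⟦ image X S α a ⟧ * fun f (section α a)} {λ a → fun f (section α a)}
                                                                 (λ a → R.trans (*-congʳ (⟦⟧-true (in-image a))) (R.*-identityˡ _)) ⟨
        total S α f                                         ∎
        where
        sumf = sumOver (finite α) (λ a → fun f (section α a))
        in-image : ∀ a → image X S α a
        in-image a = section α a , full _ , proj₂ (lift α a)

      whole-average : ∀ {μ} → IsProcountingWhole X μ → ∀ {α f} → FactorsAt f α → apply μ f ≈ average α f
      whole-average {μ} w {α} {f} h = R.trans
        (apply-cong μ (λ x → h _ _ (L.sym (proj₂ (lift α _)))))
        (w α (record { to = λ a → fun f (section α a) ; cong = λ e → h _ _ (L.trans (proj₂ (lift α _)) (L.trans e (L.sym (proj₂ (lift α _))))) }))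
        where module L = Setoid (level α)

      module _ {μX} (w : IsProcountingWhole X μX) (S : Subset X) where

        -- The product of f with the indicator of the preimage of π_α(S) factors through level α, so
        -- μ_X acts on it as the average there; the scaling then cancels the cardinalities.
        μ̃-mean : ∃ (Subset.member S) → ∀ {α f} → FactorsAt f α → IsMean S α f (apply (μ̃ X μX S α) f)
        μ̃-mean s {α} {f} h = begin
          count S α * (ι (n // c) * apply μX g)                    ≈⟨ *-cong (card-sum (finite α) (image X S α))
                                                                        (*-congˡ (whole-average {μX} w {α} {g} g-factors)) ⟩
          ι (c // 1) * (ι (n // c) * (ι (1 // n) * sumg))          ≈⟨ solve 4 (λ a b c d → a :* (b :* (c :* d)) := (a :* (b :* c)) :* d) R.refl _ _ _ _ ⟩
          (ι (c // 1) * (ι (n // c) * ι (1 // n))) * sumg          ≈⟨ *-congʳ (ι-// (size-positive α) (card-positive {S} s α)) ⟩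
          1# * sumg                                                ≈⟨ R.*-identityˡ _ ⟩
          sumg                                                     ≈⟨ sumOver-cong (finite α)
                                                                        {λ a → fun g (section α a)} {λ a → ⟦ image X S α a ⟧ * fun f (section α a)}
                                                                        (λ a → *-congʳ (⟦⟧-image (proj₂ (lift α a)))) ⟩
          total S α f                                              ∎
          where
          module L = Setoid (level α)
          n = ∣level α ∣
          c = card (finite α) (image X S α)
          ⟦⟧-image : ∀ {a b} → a L.≈ b → ⟦ image X S α a ⟧ ≈ ⟦ image X S α b ⟧
          ⟦⟧-image e = ⟦⟧-⇔ (λ (x , m , e′) → x , m , L.trans e′ e) (λ (x , m , e′) → x , m , L.trans e′ (L.sym e))
          g : LocallyConstant X
          g = _⊗_ X (𝟏-preimage X α (image X S α) (λ e (x , m , e′) → x , m , L.trans e′ e)) f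
          g-factors : FactorsAt g α
          g-factors x y e = *-cong (⟦⟧-image e) (h x y e)
          sumg = sumOver (finite α) (λ a → fun g (section α a))

        μ̃-empty : ¬ ∃ (Subset.member S) → ∀ α f → apply (μ̃ X μX S α) f ≈ 0#
        -- The image of S has cardinality 0, and division by 0 makes the scaling vanish.
        μ̃-empty ¬s α f = R.trans (*-congʳ (R.trans
          (R.reflexive (≡.cong (λ k → ι (∣level α ∣ // k)) (card-empty (finite α) (image X S α) (λ a (x , m , _) → ¬s (x , m)))))
          ι-0)) (R.zeroˡ _)

      -- A mean of point masses at the chosen lifts. Functions that factor through level α do not
      -- see the choice; for the product, these distributions converge to μ_X.
      averageDistribution : Index → Distribution X
      averageDistribution α = record
        { apply      = average α
        ; apply-cong = λ {f} {g} e → *-congˡ (sumOver-cong (finite α)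
            {λ a → fun f (section α a)} {λ a → fun g (section α a)} (λ a → e (section α a)))
        ; apply-⊕    = λ f g → R.trans (*-congˡ (∑-distrib-+
            (λ j → fun f (section α (Finite.element (finite α) j))) (λ j → fun g (section α (Finite.element (finite α) j)))))
            (R.distribˡ _ _ _)
        ; apply-⊙    = λ r f → R.trans
            (*-congˡ (R.sym (*-distribˡ-sum r (λ j → fun f (section α (Finite.element (finite α) j))))))
            (solve 3 (λ a b c → a :* (b :* c) := b :* (a :* c)) R.refl _ _ _)
        }

    open Nets R isPreorder index₀ directed

    limitDistribution : (ν : Index → Distribution X) →
      (∀ f → ∃ λ l → (λ α → apply (ν α) f) ⟶ l) →
      ∃ λ μ → ∀ f → (λ α → apply (ν α) f) ⟶ apply μ f
    limitDistribution ν lim = record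
      { apply      = λ f → proj₁ (lim f)
      ; apply-cong = λ {f} {g} e → ⟶-unique (proj₂ (lim f))
          (⟶-cong (always (λ α → apply-cong (ν α) (λ x → R.sym (e x)))) R.refl (proj₂ (lim g)))
      ; apply-⊕    = λ f g → ⟶-unique (proj₂ (lim _))
          (⟶-cong (always (λ α → R.sym (apply-⊕ (ν α) f g))) R.refl (⟶-+ (proj₂ (lim f)) (proj₂ (lim g))))
      ; apply-⊙    = λ r f → ⟶-unique (proj₂ (lim _))
          (⟶-cong (always (λ α → R.sym (apply-⊙ (ν α) r f))) R.refl (⟶-* (⟶-const r) (proj₂ (lim f))))
      } , λ f → proj₂ (lim f)

  -- Products

  module TensorProduct {I : Set} (Y : I → Presentation) (c : ∀ i → AscendingSequence (Y i)) where

    open Product em Y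
    open ProductIndex
    open FiniteSubset
    private
      module Y i = Presentation (Y i)
      module c i = AscendingSequence (c i)

    module _ (α : ProductIndex) where

      private K = elements (support α)

      extendAt : (x : ∀ i → i ∈ K → Y.Point i) → (∀ i → Y.Point i) → ∀ i → Dec (i ∈ K) → Y.Point i
      extendAt x y i (yes p) = x i p
      extendAt x y i (no _)  = y i

      extend : (x : ∀ i → i ∈ K → Y.Point i) → (∀ i → Y.Point i) → ∀ i → Y.Point i
      extend x y i = extendAt x y i em

      extend-∈ : ∀ x y i p → extend x y i ≡ x i p
      extend-∈ x y i p with em {i ∈ K}
      ... | yes p′ = ≡.cong (x i) (same (support α) p′ p)
      ... | no ¬p  = contradiction p ¬p

      extend-all : (P : ∀ i → Y.Point i → Set) → ∀ x y →
        (∀ i p → P i (x i p)) → (∀ i → P i (y i)) → ∀ i → P i (extend x y i)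
      extend-all P x y hx hy i with em {i ∈ K}
      ... | yes p = hx i p
      ... | no _  = hy i

    lift : ∀ i → Surjective (Y i)
    lift i = π-surjective (c i)

    -- Lifted coordinate by coordinate, with base points off the support.
    liftᴾ : Surjective product
    liftᴾ α a = extend α x Y.point₀ , λ i p →
      ≡.subst (λ z → Setoid._≈_ (Y.level i (at α i p)) (Y.π i (at α i p) z) (a i p))
        (≡.sym (extend-∈ α x Y.point₀ i p)) (proj₂ (lift i (at α i p) (a i p)))
      where
      x : ∀ i → i ∈ elements (support α) → Y.Point i
      x i p = proj₁ (lift i (at α i p) (a i p))

    -- A cofinal sequence for a countable product

    module _ (e : I ↣ ℕ) where

      private
        code : I → ℕ
        code = Injection.to e

      coded : ∀ n → Dec (∃ λ i → code i ≡ n) → List I → List I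
      coded n (yes (i , _)) K = i ∷ K
      coded n (no _)        K = K

      below : ℕ → List I
      below zero    = []
      below (suc n) = coded n em (below n)

      below-mono : ∀ n → below n ⊆ below (suc n)
      below-mono n p with em {∃ λ i → code i ≡ n}
      ... | yes _ = there p
      ... | no _  = p

      below-suc : ∀ n {i} → code i ≡ n → i ∈ below (suc n)
      below-suc n {i} eq with em {∃ λ i → code i ≡ n}
      ... | yes (j , eq′) = here (Injection.injective e (≡.trans eq (≡.sym eq′)))
      ... | no none       = contradiction (i , eq) none

      ∈-below : ∀ {i n} → code i ℕ.<′ n → i ∈ below n
      ∈-below (ℕ.≤′-reflexive refl)  = below-suc _ refl
      ∈-below (ℕ.≤′-step p)          = below-mono _ (∈-below p)

      private
        _≟_ : (i j : I) → Dec (i ≡ j)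
        _ ≟ _ = em

      -- A diagonal: the n-th index involves the coordinates with code below n, each at the n-th
      -- member of its own sequence.
      ascendingᴾ : AscendingSequence product
      ascendingᴾ = record
        { chain   = chain
        ; ascends = λ n i p →
            ∈-deduplicate⁺ _≟_ (below-mono n (∈-deduplicate⁻ _≟_ (below n) p)) , c.ascends i n
        ; cofinal = λ α →
            -- The bound exceeds the codes of the support, strictly because `below n` holds codes
            -- less than n, and also the positions that the components of α require.
            let n , h = listBound (elements (support α)) (λ i p → suc (code i) ℕ.⊔ proj₁ (c.cofinal i (at α i p)))
            in n , λ i p →
              ∈-deduplicate⁺ _≟_ (∈-below (ℕ.≤⇒≤′ (ℕ.≤-trans (ℕ.m≤m⊔n (suc (code i)) (proj₁ (c.cofinal i (at α i p)))) (h i p)))) ,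
              Y.≤-trans i (proj₂ (c.cofinal i (at α i p)))
                (c.chain-mono i (ℕ.≤-trans (ℕ.m≤n⊔m (suc (code i)) _) (h i p)))
        }
        where
        chain : ℕ → ProductIndex
        -- The list has no repetitions, as codes are injective; deduplicating it merely supplies the
        -- proof.
        chain n .support .elements = deduplicate _≟_ (below n)
        chain n .support .unique   = UniqueDec.deduplicate-! _≟_ (below n)
        chain n .at i _            = c.chain i n

    -- Means of rectangular functions

    sum-Π : ∀ K (F : ∀ i → i ∈ K → Setoid 0ℓ 0ℓ) (fin : ∀ i p → Finite (F i p))
      (u : ∀ i p → Setoid.Carrier (F i p) → Carrier) →
      sumOver (Π-finite K F fin) (λ b → ∏ᵈ K (λ i p → u i p (b i p)))
        ≈ ∏ᵈ K (λ i p → sumOver (fin i p) (u i p))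
    sum-Π []      F fin u = R.+-identityʳ 1#
    sum-Π (k ∷ K) F fin u = R.trans
      (sum-remQuot {Finite.size (fin k (here refl))} (Finite.size tailFinite)
        (λ j → u k (here refl) (Finite.element (fin k (here refl)) j))
        (λ j → ∏ᵈ K (λ i p → u i (there p) (Finite.element tailFinite j i p))))
      (*-congˡ (sum-Π K _ _ (λ i p → u i (there p))))
      where tailFinite = Π-finite K (λ i p → F i (there p)) (λ i p → fin i (there p))

    -- F (x) = ∏ f_i (x_i), where f_i depends on x_i at level γ_i only and is 1 off the support of γ.
    record Rectangular (γ : ProductIndex) (F : LocallyConstant product) (f : ∀ i → LocallyConstant (Y i)) : Set where
      field
        factorisation : ∀ x → fun F x ≈ ∏ (elements (support γ)) (λ i → fun (f i) (x i))
        factors       : ∀ i p → FactorsAt (f i) (at γ i p)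
        trivial       : ∀ i → i ∉ elements (support γ) → ∀ y → fun (f i) y ≈ 1#

    open Rectangular

    ∏-support : ∀ {γ α} → γ ≤ᴾ α → (g : I → Carrier) → (∀ i → i ∉ elements (support γ) → g i ≈ 1#) →
      ∏ (elements (support α)) g ≈ ∏ (elements (support γ)) g
    ∏-support {γ} {α} le g one = ∏-⊆ g (unique (support γ)) (unique (support α))
      (λ p → proj₁ (le _ p)) (λ i _ → one i)

    Rectangular-mono : ∀ {γ α F f} → γ ≤ᴾ α → Rectangular γ F f → Rectangular α F f
    Rectangular-mono {γ} {α} {F} {f} le r = record
      { factorisation = λ x → R.trans (factorisation r x)
          (R.sym (∏-support {γ} {α} le _ (λ i i∉ → trivial r i i∉ (x i))))
      ; factors       = factors′
      ; trivial       = λ i i∉ → trivial r i (λ p → i∉ (proj₁ (le i p)))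
      }
      where
      factors′ : ∀ i p → FactorsAt (f i) (at α i p)
      factors′ i p with em {i ∈ elements (support γ)}
      ... | yes q = FactorsAt-mono {f = f i} (≤ᴾ-at {γ} {α} le i q p) (factors r i q)
      ... | no i∉ = λ x y _ → R.trans (trivial r i i∉ x) (R.sym (trivial r i i∉ y))

    module _ {T : ∀ i → Subset (Y i)} (t : ∀ i → ∃ (Subset.member (T i))) where

      private S = productSubset T

      -- Membership in the image constrains only the coordinates in the support; the others are
      -- filled with the given points of the T_i, which is where nonemptiness enters.
      image-∏ : ∀ α a → ⟦ image product S α a ⟧ ≈
        ∏ᵈ (elements (support α)) (λ i p → ⟦ image (Y i) (T i) (at α i p) (a i p) ⟧)
      image-∏ α a = R.trans
        (⟦⟧-⇔ (λ (x , m , e) i p → x i , m i , e i p)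
              (λ h → extend α (λ i p → proj₁ (h i p)) (λ i → proj₁ (t i))
                   , extend-all α (λ i → Subset.member (T i)) _ _ (λ i p → proj₁ (proj₂ (h i p))) (λ i → proj₂ (t i))
                   , λ i p → ≡.subst (λ z → Setoid._≈_ (Y.level i (at α i p)) (Y.π i (at α i p) z) (a i p))
                       (≡.sym (extend-∈ α _ _ i p)) (proj₂ (proj₂ (h i p)))))
        (∏ᵈ-⟦⟧ _ _)

      -- Both the number of points of the image and the sum of F over it split, by `sum-Π`, into
      -- products over the support, so the equations defining the means multiply factor by factor.
      mean-∏ : ∀ {α F f} → Rectangular α F f → (e : ∀ i → i ∈ elements (support α) → Carrier) →
        (∀ i p → IsMean (lift i) (T i) (at α i p) (f i) (e i p)) →
        IsMean liftᴾ S α F (∏ᵈ (elements (support α)) e)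
      mean-∏ {α} {F} {f} r e m = begin
        count liftᴾ S α * ∏ᵈ K e
          ≈⟨ *-congʳ (R.trans (sumOver-cong fin {image₁} {λ a → ∏ᵈ K (λ i p → image₂ i p (a i p))} (image-∏ α)) (sum-Π K _ _ image₂)) ⟩
        ∏ᵈ K (λ i p → count (lift i) (T i) (at α i p)) * ∏ᵈ K e
          ≈⟨ R.trans (∏ᵈ-* K _ e) (∏ᵈ-cong K m) ⟩
        ∏ᵈ K (λ i p → total (lift i) (T i) (at α i p) (f i))
          ≈⟨ sum-Π K _ _ (λ i p a → image₂ i p a * fun (f i) (section {Y i} (lift i) (at α i p) a)) ⟨
        sumOver fin (λ a → ∏ᵈ K (λ i p → image₂ i p (a i p) * fun (f i) (section {Y i} (lift i) (at α i p) (a i p))))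
          ≈⟨ sumOver-cong fin {λ a → image₁ a * fun F (section {product} liftᴾ α a)}
               {λ a → ∏ᵈ K (λ i p → image₂ i p (a i p) * fun (f i) (section {Y i} (lift i) (at α i p) (a i p)))}
               (λ a → R.trans (*-cong (image-∏ α a) (value a)) (∏ᵈ-* K _ _)) ⟨
        total liftᴾ S α F ∎
        where
        K = elements (support α)
        fin = Presentation.finite product α
        image₁ : Setoid.Carrier (levelᴾ α) → Carrier
        image₁ a = ⟦ image product S α a ⟧
        image₂ : ∀ i p → Setoid.Carrier (Y.level i (at α i p)) → Carrier
        image₂ i p a = ⟦ image (Y i) (T i) (at α i p) a ⟧
        -- The lift in the product and the lifts in the factors agree only at the levels given by α,
        -- which suffices as each f_i factors there.
        value : ∀ a → fun F (section {product} liftᴾ α a) ≈ ∏ᵈ K (λ i p → fun (f i) (section {Y i} (lift i) (at α i p) (a i p)))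
        value a = R.trans (factorisation r _) (R.sym (∏ᵈ-∏ K _ _ (λ i p →
          let open Setoid (Y.level i (at α i p)) using (trans; sym) in
          factors r i p _ _ (trans (proj₂ (lift i (at α i p) (a i p))) (sym (proj₂ (liftᴾ α a) i p))))))

    -- The side of the box that is the fibre over a. Off the support the condition is vacuous and
    -- the side is all of Y_i. It is a `CompactOpen` since `WeakLimit` speaks of such sets only.
    fibreFactor : ∀ γ → Setoid.Carrier (levelᴾ γ) → ∀ i → CompactOpen (Y i)
    fibreFactor γ a i = compactOpen em (c i) (λ y → ∀ p → Setoid._≈_ (Y.level i (at γ i p)) (Y.π i (at γ i p) y) (a i p)) level-of
      where
      level-of : ∃ λ δ → ∀ x y → Presentation._≈[_]_ (Y i) x δ y →
        (∀ p → Setoid._≈_ (Y.level i (at γ i p)) (Y.π i (at γ i p) x) (a i p)) →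
        (∀ p → Setoid._≈_ (Y.level i (at γ i p)) (Y.π i (at γ i p) y) (a i p))
      level-of with em {i ∈ elements (support γ)}
      ... | yes p = at γ i p , λ x y e h q → invariant q (same (support γ) p q) x y e (h q)
        where
        invariant : ∀ q → p ≡ q → ∀ x y → Presentation._≈[_]_ (Y i) x (at γ i p) y →
          Setoid._≈_ (Y.level i (at γ i q)) (Y.π i (at γ i q) x) (a i q) →
          Setoid._≈_ (Y.level i (at γ i q)) (Y.π i (at γ i q) y) (a i q)
        invariant q refl x y e h = Setoid.trans (Y.level i (at γ i q)) (Setoid.sym (Y.level i (at γ i q)) e) h
      ... | no i∉ = Y.index₀ i , λ x y e h p → contradiction p i∉

    fibre-rectangular : ∀ γ a → Rectangular γ (fibre {product} γ a) (λ i → 𝟏 (Y i) (fibreFactor γ a i))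
    fibre-rectangular γ a = record
      { factorisation = λ x → R.trans (∏ᵈ-⟦⟧ K _) (∏ᵈ-∏ K _ _ (λ i p → local i p (x i)))
      ; factors       = λ i p x y e → R.trans (R.sym (local i p x))
          (R.trans (⟦⟧-⇔ (L.trans i p (L.sym i p e)) (L.trans i p e)) (local i p y))
      ; trivial       = λ i i∉ y → ⟦⟧-true (λ p → contradiction p i∉)
      }
      where
      K = elements (support γ)
      module L i p = Setoid (Y.level i (at γ i p))
      local : ∀ i p y → ⟦ L._≈_ i p (Y.π i (at γ i p) y) (a i p) ⟧ ≈
        ⟦ (∀ q → L._≈_ i q (Y.π i (at γ i q) y) (a i q)) ⟧
      local i p y = ⟦⟧-⇔ (λ e q → ≡.subst (λ q → L._≈_ i q (Y.π i (at γ i q) y) (a i q)) (same (support γ) p q) e)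
                         (λ h → h p)

    -- Compact open boxes

    module _ {V : ∀ i → CompactOpen (Y i)} {U : CompactOpen product} (box : _IsBox_ Y U V)
             (u : ∃ (CompactOpen.carrier U)) where

      private
        γ = proj₁ (compactOpen-level product U)
        K = elements (support γ)

        replace : ∀ i → Y.Point i → ∀ j → Dec (j ≡ i) → Y.Point j
        replace i y j (yes refl) = y
        replace i y j (no _)     = proj₁ u j

        replaced : ∀ i → Y.Point i → ∀ j → Y.Point j
        replaced i y j = replace i y j em

        replaced-at : ∀ i y → replaced i y i ≡ y
        replaced-at i y with em {i ≡ i}
        ... | yes refl = refl
        ... | no i≢i   = contradiction refl i≢i

        replaced-all : (P : ∀ j → Y.Point j → Y.Point j → Set) → ∀ i x y → P i x y →
          (∀ j → P j (proj₁ u j) (proj₁ u j)) → ∀ j → P j (replaced i x j) (replaced i y j)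
        replaced-all P i x y h hu j with em {j ≡ i}
        ... | yes refl = h
        ... | no _     = hu j

        in-box : ∀ i → CompactOpen.carrier (V i) (proj₁ u i)
        in-box = Equivalence.to (box (proj₁ u)) (proj₂ u)

        -- Put x and y in turn into coordinate i of a point of U. The two results agree at γ, so U
        -- contains both, and the box condition at i carries membership over. Off the support
        -- nothing is asked of x and y, so there V i is everything.
        invariant : ∀ i x y → (∀ p → Presentation._≈[_]_ (Y i) x (at γ i p) y) →
          CompactOpen.carrier (V i) x → CompactOpen.carrier (V i) y
        invariant i x y e v = ≡.subst (CompactOpen.carrier (V i)) (replaced-at i y)
          (Equivalence.to (box (replaced i y))
            (proj₂ (compactOpen-level product U) (replaced i x) (replaced i y)
              (λ j p → replaced-all (λ j x y → ∀ p → Presentation._≈[_]_ (Y j) x (at γ j p) y)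
                i x y e (λ j p → Setoid.refl (Y.level j (at γ j p))) j p)
              (Equivalence.from (box (replaced i x))
                (replaced-all (λ j x _ → CompactOpen.carrier (V j) x) i x x v in-box))) i)

        off-support : ∀ i → i ∉ K → ∀ y → CompactOpen.carrier (V i) y
        off-support i i∉ y = invariant i (proj₁ u i) y (λ p → contradiction p i∉) (in-box i)

      box-rectangular : ∃ λ γ → Rectangular γ (𝟏 product U) (λ i → 𝟏 (Y i) (V i))
      box-rectangular = γ , record
        { factorisation = λ x → R.trans
            (⟦⟧-⇔ (λ m i p → Equivalence.to (box x) m i) (λ h → Equivalence.from (box x) (inside x h)))
            (R.trans (∏ᵈ-⟦⟧ K _) (∏ᵈ-∏ K _ _ (λ i p → R.refl)))
        ; factors       = λ i p x y e → ⟦⟧-⇔ (invariant i x y (at-same i p e))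
            (invariant i y x (at-same i p (Setoid.sym (Y.level i (at γ i p)) e)))
        ; trivial       = λ i i∉ y → ⟦⟧-true (off-support i i∉ y)
        }
        where
        inside : ∀ x → (∀ i → i ∈ K → CompactOpen.carrier (V i) (x i)) → ∀ i → CompactOpen.carrier (V i) (x i)
        inside x h i with em {i ∈ K}
        ... | yes p = h i p
        ... | no i∉ = off-support i i∉ (x i)
        at-same : ∀ i p {x y} → Presentation._≈[_]_ (Y i) x (at γ i p) y →
          ∀ q → Presentation._≈[_]_ (Y i) x (at γ i q) y
        at-same i p {x} {y} e q = ≡.subst (λ q → Presentation._≈[_]_ (Y i) x (at γ i q) y) (same (support γ) p q) e

    private
      module Yᴺ i = Nets R (Y.isPreorder i) (Y.index₀ i) (Y.directed i)
    open Nets R (Presentation.isPreorder product) (Presentation.index₀ product) (Presentation.directed product)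

    -- Existence of the procounting distribution of the product

    module _ {μY : ∀ i → Distribution (Y i)} (w : ∀ i → IsProcountingWhole (Y i) (μY i)) where

      private
        W : ∀ i → Subset (Y i)
        W i = wholeSubset (Y i)

        nonempty : ∀ i → ∃ (Subset.member (W i))
        nonempty i = Y.point₀ i , tt

      whole-mean : ∀ i {α f} → FactorsAt f α → IsMean (lift i) (W i) α f (apply (μY i) f)
      whole-mean i {α} {f} h = R.trans
        (*-congˡ (whole-average (lift i) {μY i} (w i) {α} {f} h))
        (average-mean (lift i) {W i} (λ _ → tt) α f)

      whole-one : ∀ i f → (∀ y → fun f y ≈ 1#) → apply (μY i) f ≈ 1#
      whole-one i f one = mean-unique (lift i) {W i} (nonempty i) {Y.index₀ i} {f}
        (whole-mean i {Y.index₀ i} {f} (λ x y _ → R.trans (one x) (R.sym (one y))))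
        (mean-one (lift i) {W i} (nonempty i) {Y.index₀ i} {f} one)

      -- This is `mean-∏` for T_i = Y_i. The right-hand side depends on the support but no longer on
      -- the levels.
      average-rectangular : ∀ {γ F f} → Rectangular γ F f →
        average {product} liftᴾ γ F ≈ ∏ (elements (support γ)) (λ i → apply (μY i) (f i))
      average-rectangular {γ} {F} {f} r = R.trans
        (mean-unique {product} liftᴾ {productSubset W} (Y.point₀ , λ _ → tt) {γ} {F}
          (average-mean {product} liftᴾ {productSubset W} (λ _ _ → tt) γ F)
          (mean-∏ {W} nonempty r (λ i _ → apply (μY i) (f i))
            (λ i p → whole-mean i {at γ i p} {f i} (Rectangular.factors r i p))))
        (∏ᵈ-∏ (elements (support γ)) (λ i _ → apply (μY i) (f i)) (λ i → apply (μY i) (f i)) (λ i p → R.refl))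

      -- By linearity F may be a fibre over γ, which is rectangular. Passing from γ to α then only
      -- adds factors, the masses of whole spaces Y_i, all equal to 1.
      average-stable : ∀ {F γ α} → FactorsAt F γ → γ ≤ᴾ α → average {product} liftᴾ α F ≈ average {product} liftᴾ γ F
      average-stable {F} {γ} {α} h γ≤α = R.trans
        (apply-fibres {product} liftᴾ (averageDistribution {product} liftᴾ α) F γ h)
        (R.trans
          (sum-cong-≋ (λ j → *-congˡ (fibre-stable (Finite.element (Presentation.finite product γ) j))))
          (R.sym (apply-fibres {product} liftᴾ (averageDistribution {product} liftᴾ γ) F γ h)))
        where
        fibre-stable : ∀ a → average {product} liftᴾ α (fibre {product} γ a) ≈ average {product} liftᴾ γ (fibre {product} γ a)
        fibre-stable a = R.trans (average-rectangular (Rectangular-mono {γ} {α} γ≤α r))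
          (R.trans (∏-support {γ} {α} γ≤α _ (λ i i∉ → whole-one i _ (Rectangular.trivial r i i∉)))
                   (R.sym (average-rectangular r)))
          where r = fibre-rectangular γ a

      product-whole : I ↣ ℕ → ∃ λ μ → IsProcountingWhole product μ
      product-whole e = from-limit limit
        where
        ν : ProductIndex → Distribution product
        ν = averageDistribution {product} liftᴾ

        from-limit : (∃ λ μ → ∀ F → (λ α → apply (ν α) F) ⟶ apply μ F) → ∃ λ μ → IsProcountingWhole product μ
        from-limit (μ , h) = μ , λ α g →
          ⟶-unique {λ β → apply (ν β) (pullback product α g)} (h (pullback product α g))
            (⟶-eventually {λ β → apply (ν β) (pullback product α g)} (α , λ β α≤β → R.trans
              (average-stable {pullback product α g} {α} {β} (λ x y e → Func.cong g e) α≤β)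
              (*-congˡ (sumOver-cong (Presentation.finite product α)
                {λ a → Func.to g (Presentation.π product α (section {product} liftᴾ α a))} {Func.to g}
                (λ a → Func.cong g (proj₂ (liftᴾ α a)))))))

        limit : ∃ λ μ → ∀ F → (λ α → apply (ν α) F) ⟶ apply μ F
        limit = limitDistribution {product} ν (λ F →
          -- Countability enters here: compactness turns the levels attached to the single points
          -- into one level for F.
          let γ , h = uniform em (ascendingᴾ e) _≈_ (λ p q → R.trans (R.sym p) q) (fun F) (locallyConstant F)
          in average {product} liftᴾ γ F ,
             ⟶-eventually {λ α → apply (ν α) F} (γ , λ α γ≤α → average-stable {F} {γ} {α} h γ≤α))

    -- Convergence on rectangular functions

    module _ {μY : ∀ i → Distribution (Y i)} (w : ∀ i → IsProcountingWhole (Y i) (μY i))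
             {μX : Distribution product} (wX : IsProcountingWhole product μX)
             {T : ∀ i → Subset (Y i)} (t : ∀ i → ∃ (Subset.member (T i))) where

      private
        S = productSubset T

      μ̃-one : ∀ i α f → (∀ y → fun f y ≈ 1#) → apply (μ̃ (Y i) (μY i) (T i) α) f ≈ 1#
      μ̃-one i α f one = mean-unique (lift i) {T i} (t i) {α} {f}
        (μ̃-mean (lift i) {μY i} (w i) (T i) (t i) {α} {f} (λ x y _ → R.trans (one x) (R.sym (one y))))
        (mean-one (lift i) {T i} (t i) {α} {f} one)

      module _ {F : LocallyConstant product} {f : ∀ i → LocallyConstant (Y i)} where

        -- The value 1 off the support turns each factor into a net over all product indices.
        factorAt : ∀ α i → Dec (i ∈ elements (support α)) → Carrier
        factorAt α i (yes p) = apply (μ̃ (Y i) (μY i) (T i) (at α i p)) (f i)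
        factorAt α i (no _)  = 1#

        factor : ProductIndex → I → Carrier
        factor α i = factorAt α i em

        factor-∈ : ∀ α i p → factor α i ≡ apply (μ̃ (Y i) (μY i) (T i) (at α i p)) (f i)
        factor-∈ α i p with em {i ∈ elements (support α)}
        ... | yes p′ = ≡.cong (λ p → apply (μ̃ (Y i) (μY i) (T i) (at α i p)) (f i)) (same (support α) p′ p)
        ... | no ¬p  = contradiction p ¬p

        factor-trivial : ∀ α i → (∀ y → fun (f i) y ≈ 1#) → factor α i ≈ 1#
        factor-trivial α i one with em {i ∈ elements (support α)}
        ... | yes p = μ̃-one i (at α i p) (f i) one
        ... | no _  = R.refl

        -- Lying above `single i d` means having i in the support with component at least d, so the
        -- tail of the net over the indices of Y_i governs this one.
        factor-limit : ∀ i {l} → Yᴺ._⟶_ i (λ a → apply (μ̃ (Y i) (μY i) (T i) a) (f i)) l →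
          (λ α → factor α i) ⟶ l
        factor-limit i {l} conv ε 0<ε with d , h ← conv ε 0<ε = single i d , λ α d≤α →
          let p , d≤αᵢ = d≤α i (here refl)
          in ≡.subst (λ x → Small ε (x R.- l)) (≡.sym (factor-∈ α i p)) (h _ d≤αᵢ)

        -- The product stays over the support of γ while α grows, since the further f_i are 1 and
        -- have mean 1. A fixed finite number of nets remains.
        μ̃-rectangular : ∀ {γ} → Rectangular γ F f → ∀ α → γ ≤ᴾ α →
          apply (μ̃ product μX S α) F ≈ ∏ (elements (support γ)) (factor α)
        μ̃-rectangular {γ} r α γ≤α = R.trans
          (mean-unique {product} liftᴾ {S} ((λ i → proj₁ (t i)) , (λ i → proj₂ (t i))) {α} {F}
            (μ̃-mean {product} liftᴾ {μX} wX S ((λ i → proj₁ (t i)) , (λ i → proj₂ (t i))) {α} {F} F-factors)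
            (mean-∏ {T} t r′ (λ i p → apply (μ̃ (Y i) (μY i) (T i) (at α i p)) (f i)) (λ i p →
              μ̃-mean (lift i) {μY i} (w i) (T i) (t i) {at α i p} {f i} (Rectangular.factors r′ i p))))
          (R.trans (∏ᵈ-∏ K (λ i p → apply (μ̃ (Y i) (μY i) (T i) (at α i p)) (f i)) (factor α)
              (λ i p → R.sym (R.reflexive (factor-∈ α i p))))
            (∏-support {γ} {α} γ≤α (factor α) (λ i i∉ → factor-trivial α i (Rectangular.trivial r i i∉))))
          where
          K = elements (support α)
          r′ = Rectangular-mono {γ} {α} γ≤α r
          F-factors : FactorsAt F α
          F-factors x y e = R.trans (Rectangular.factorisation r′ x)
            (R.trans (∏-cong K {λ i → fun (f i) (x i)} {λ i → fun (f i) (y i)}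
                       (λ i p → Rectangular.factors r′ i p (x i) (y i) (e i p)))
              (R.sym (Rectangular.factorisation r′ y)))

        μ̃-limit : ∀ {γ} → Rectangular γ F f → ∀ {l : I → Carrier} →
          (∀ i → Yᴺ._⟶_ i (λ a → apply (μ̃ (Y i) (μY i) (T i) a) (f i)) (l i)) →
          (λ α → apply (μ̃ product μX S α) F) ⟶ ∏ (elements (support γ)) l
        μ̃-limit {γ} r {l} conv = ⟶-cong (γ , λ α γ≤α → R.sym (μ̃-rectangular r α γ≤α)) R.refl
          (⟶-∏ (elements (support γ)) {λ i α → factor α i} {l} (λ i _ → factor-limit i (conv i)))

    module _ {f : I → Carrier} {l : Carrier} where

      isProduct-eventually : (K₀ : FiniteSubset I) → (∀ K → K₀ ⊑ K → ∏ (elements K) f ≈ l) → IsProduct f l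
      isProduct-eventually K₀ h ε 0<ε = K₀ , λ K K₀⊑K → Small-≈ 0<ε (h K K₀⊑K)

      isProduct-zero : ∀ i → f i ≈ 0# → l ≈ 0# → IsProduct f l
      isProduct-zero i fi≈0 l≈0 = isProduct-eventually (record { elements = i ∷ [] ; unique = All.[] ∷ [] })
        (λ K i∈K → R.trans (∏-zero f (i∈K (here refl)) fi≈0) (R.sym l≈0))

    -- For A i an existential, hence a pair, the result is a choice function.
    choose : ∀ {A : I → Set} → ¬ (∃ λ i → ¬ A i) → ∀ i → A i
    choose {A} none i with em {A i}
    ... | yes a = a
    ... | no ¬a = contradiction (i , ¬a) none

    -- Existence of μ_S and the product formula

    module _ {T : ∀ i → Subset (Y i)} {μT : ∀ i → Distribution (Y i)}
             (procounting : ∀ i → IsProcounting (Y i) (T i) (μT i)) where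

      private
        S = productSubset T
        μY : ∀ i → Distribution (Y i)
        μY i = proj₁ (procounting i)
        w : ∀ i → IsProcountingWhole (Y i) (μY i)
        w i = proj₁ (proj₂ (procounting i))
        conv : ∀ i → WeakLimit (Y i) (μ̃ (Y i) (μY i) (T i)) (μT i)
        conv i = proj₂ (proj₂ (procounting i))

      procounting-whole : I ↣ ℕ → ∃ λ μX → IsProcountingWhole product μX
      procounting-whole = product-whole {μY} w

      empty-exists : (∃ λ μX → IsProcountingWhole product μX) →
        ¬ ∃ (Subset.member S) → ∃ λ μS → IsProcounting product S μS
      -- `scale product 0# μX` stands for the zero distribution.
      empty-exists (μX , wX) ¬s = scale product 0# μX , μX , wX , λ U → ⟶-eventually
        (always (λ α → R.trans (μ̃-empty {product} liftᴾ {μX} wX S ¬s α (𝟏 product U)) (R.sym (R.zeroˡ _))))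

      empty-tensor : ∀ i → ¬ ∃ (Subset.member (T i)) → ∀ {μS} → IsProcounting product S μS → IsTensorProduct Y μT μS
      empty-tensor i ¬tᵢ (μX , wX , weak) V U _ = isProduct-zero i
        (Yᴺ.⟶-unique i (conv i (V i)) (Yᴺ.⟶-eventually i
          (Yᴺ.always i (λ a → μ̃-empty (lift i) {μY i} (w i) (T i) ¬tᵢ a (𝟏 (Y i) (V i))))))
        (⟶-unique (weak U) (⟶-eventually (always (λ α →
          μ̃-empty {product} liftᴾ {μX} wX S (λ (x , m) → ¬tᵢ (x i , m i)) α (𝟏 product U)))))

      module _ (t : ∀ i → ∃ (Subset.member (T i))) where

        nonempty-exists : I ↣ ℕ → (∃ λ μX → IsProcountingWhole product μX) →
          ∃ λ μS → IsProcounting product S μS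
        nonempty-exists e (μX , wX) = from-limit limit
          where
          ν : ProductIndex → Distribution product
          ν = μ̃ product μX S

          fibreLimit : ∀ γ → Setoid.Carrier (levelᴾ γ) → Carrier
          fibreLimit γ a = ∏ (elements (support γ)) (λ i → apply (μT i) (𝟏 (Y i) (fibreFactor γ a i)))

          fibre-limit : ∀ γ a → (λ α → apply (ν α) (fibre {product} γ a)) ⟶ fibreLimit γ a
          fibre-limit γ a = μ̃-limit {μY} w {μX} wX {T} t
            {fibre {product} γ a} {λ i → 𝟏 (Y i) (fibreFactor γ a i)} {γ} (fibre-rectangular γ a)
            {λ i → apply (μT i) (𝟏 (Y i) (fibreFactor γ a i))} (λ i → conv i (fibreFactor γ a i))

          module _ (F : LocallyConstant product) {γ} (F-factors : FactorsAt F γ) where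
            private
              a : Fin (Presentation.∣level_∣ product γ) → Setoid.Carrier (levelᴾ γ)
              a = Finite.element (Presentation.finite product γ)
              r : Fin (Presentation.∣level_∣ product γ) → Carrier
              r j = fun F (section {product} liftᴾ γ (a j))

            function-limit : (λ α → apply (ν α) F) ⟶ sum (λ j → r j * fibreLimit γ (a j))
            function-limit = ⟶-cong
              {λ α → sum (λ j → r j * apply (ν α) (fibre {product} γ (a j)))} {λ α → apply (ν α) F}
              (always (λ α → R.sym (apply-fibres {product} liftᴾ (ν α) F γ F-factors))) R.refl
              (⟶-sum {x = λ j α → r j * apply (ν α) (fibre {product} γ (a j))} {a = λ j → r j * fibreLimit γ (a j)}
                (λ j → ⟶-* {λ _ → r j} {λ α → apply (ν α) (fibre {product} γ (a j))}
                  (⟶-const (r j)) (fibre-limit γ (a j))))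

          from-limit : (∃ λ μ → ∀ F → (λ α → apply (ν α) F) ⟶ apply μ F) → ∃ λ μS → IsProcounting product S μS
          from-limit (μ , h) = μ , μX , wX , λ U → h (𝟏 product U)

          limit : ∃ λ μ → ∀ F → (λ α → apply (ν α) F) ⟶ apply μ F
          limit = limitDistribution {product} ν (λ F →
            let γ , h = uniform em (ascendingᴾ e) _≈_ (λ p q → R.trans (R.sym p) q) (fun F) (locallyConstant F)
            in _ , function-limit F {γ} h)

        module _ {μS} (procountingS : IsProcounting product S μS)
                 {V : ∀ i → CompactOpen (Y i)} {U : CompactOpen product} where

          private
            f : I → Carrier
            f i = apply (μT i) (𝟏 (Y i) (V i))

          -- The partial products are constant from the support of γ on. The limit is computed with
          -- the whole-space distribution contained in `procountingS`, so that both limits are of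
          -- the same net.
          rectangle-product : ∀ {γ} → Rectangular γ (𝟏 product U) (λ i → 𝟏 (Y i) (V i)) →
            IsProduct f (apply μS (𝟏 product U))
          rectangle-product {γ} r = isProduct-eventually {f} (support γ) (λ K γ⊑K → R.trans
            (∏-⊆ f (unique (support γ)) (unique K) γ⊑K (λ i _ i∉ → trivial-limit i (Rectangular.trivial r i i∉)))
            (rectangle-limit {proj₁ procountingS} (proj₁ (proj₂ procountingS)) (proj₂ (proj₂ procountingS))))
            where
            rectangle-limit : ∀ {μX} → IsProcountingWhole product μX →
              WeakLimit product (μ̃ product μX S) μS →
              ∏ (elements (support γ)) f ≈ apply μS (𝟏 product U)
            rectangle-limit {μX} wX weak = ⟶-unique {λ α → apply (μ̃ product μX S α) (𝟏 product U)}
              (μ̃-limit {μY} w {μX} wX {T} t {𝟏 product U} {λ i → 𝟏 (Y i) (V i)} {γ} r {f} (λ i → conv i (V i)))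
              (weak U)
            trivial-limit : ∀ i → (∀ y → fun (𝟏 (Y i) (V i)) y ≈ 1#) → f i ≈ 1#
            trivial-limit i one = Yᴺ.⟶-unique i {λ a → apply (μ̃ (Y i) (μY i) (T i) a) (𝟏 (Y i) (V i))} (conv i (V i))
              (Yᴺ.⟶-eventually i (Yᴺ.always i (λ a →
                μ̃-one {μY} w {proj₁ procountingS} (proj₁ (proj₂ procountingS)) {T} t i a (𝟏 (Y i) (V i)) one)))

          empty-product : ∀ i → ¬ ∃ (CompactOpen.carrier (V i)) → ¬ ∃ (CompactOpen.carrier U) →
            IsProduct f (apply μS (𝟏 product U))
          empty-product i ¬v ¬u = isProduct-zero {f} i
            (apply-0 {Y i} (μT i) {𝟏 (Y i) (V i)} (λ y → ⟦⟧-false (λ v → ¬v (y , v))))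
            (apply-0 {product} μS {𝟏 product U} (λ x → ⟦⟧-false (λ u → ¬u (x , u))))

          box-product : _IsBox_ Y U V → Dec (∃ (CompactOpen.carrier U)) → IsProduct f (apply μS (𝟏 product U))
          box-product box (yes u) = let γ , r = box-rectangular {V} {U} box u in rectangle-product {γ} r
          box-product box (no ¬u) with em {∃ λ i → ¬ ∃ (CompactOpen.carrier (V i))}
          ... | yes (i , ¬v) = empty-product i ¬v ¬u
          -- If every V i had a point, these points together would form a point of U.
          ... | no none =
            let v = choose none
            in contradiction (_ , Equivalence.from (box (λ i → proj₁ (v i))) (λ i → proj₂ (v i))) ¬u

        nonempty-tensor : ∀ {μS} → IsProcounting product S μS → IsTensorProduct Y μT μS
        nonempty-tensor {μS} p V U box = box-product {μS} p {V} {U} box em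

      tensor : I ↣ ℕ → Dec (∃ λ i → ¬ ∃ (Subset.member (T i))) →
        (∃ λ μS → IsProcounting product S μS) × (∀ μS → IsProcounting product S μS → IsTensorProduct Y μT μS)
      tensor e (yes (i , ¬tᵢ)) = empty-exists (procounting-whole e) (λ (x , m) → ¬tᵢ (x i , m i))
                               , λ μS → empty-tensor i ¬tᵢ {μS}
      tensor e (no none)       = nonempty-exists (choose none) e (procounting-whole e)
                               , λ μS → nonempty-tensor (choose none) {μS}

theoremA : (em : ExcludedMiddle 0ℓ) (R : ValuedℚAlgebra)
    (let open Procounting em R)
    {I : Set} (countable : I ↣ ℕ)
    (Y : I → Presentation) (cofinal : ∀ i → CofinalSequence (Y i))
    (let open Product em Y)
    (whole : ∀ i → ∃ λ μ → IsProcountingWhole (Y i) μ)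
    (T : ∀ i → Subset (Y i)) (μT : ∀ i → Distribution (Y i)) →
    (∀ i → IsProcounting (Y i) (T i) (μT i)) →
    (∃ λ μS → IsProcounting product (productSubset T) μS)
    × (∀ μS → IsProcounting product (productSubset T) μS → IsTensorProduct Y μT μS)
theoremA em R countable Y cofinal whole T μT procounting =
  ProcountingTheory.TensorProduct.tensor em R Y (λ i → ascending (cofinal i)) {T} {μT} procounting countable em
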